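{- Let $F$ be a field of characteristic $0$ and let $x^*_0,\ldots,x^*_4\in\mathbb{P}^2_{F[\varepsilon]_2}$ be $5$ points in generic position, $x^*_i=x_i+x'_i\varepsilon$. Then $$\sum_{i=0}^4(-1)^i\left\langle r(x_i|x_0,\ldots,\hat{x}_i,\ldots,x_4);\,r_\varepsilon(x^*_i|x^*_0,\ldots,\hat{x}^*_i,\ldots,x^*_4)\right]_2=0\in T\mathcal{B}_2(F).$$
   Context: $F[\varepsilon]_2=F[\varepsilon]/\varepsilon^2$. Each point $x^*_i$ of $\mathbb{P}^2_{F[\varepsilon]_2}$ is represented by a vector $x_i+x'_i\varepsilon\in F[\varepsilon]_2^3$ with $x_i,x_i'\in F^3$, $x_i\neq0$. $\Delta$ is the $3\times3$ determinant; generic position means $\Delta(x_i,x_j,x_k)\ne0$ for pairwise distinct $i,j,k$. **Projected cross-ratio.** For distinct indices, $$\mathbf{r}(x^*_i|x^*_j,x^*_k,x^*_l,x^*_m)=\frac{\Delta(x^*_i,x^*_j,x^*_m)\,\Delta(x^*_i,x^*_k,x^*_l)}{\Delta(x^*_i,x^*_j,x^*_l)\,\Delta(x^*_i,x^*_k,x^*_m)}=r(x_i|x_j,x_k,x_l,x_m)+r_\varepsilon(x^*_i|x^*_j,x^*_k,x^*_l,x^*_m)\,\varepsilon\in F[\varepsilon]_2,$$ i.e. $r$ and $r_\varepsilon$ are the coefficients of $\varepsilon^0$ and $\varepsilon^1$ of the cross-ratio of the four points projected from the fifth. **The group $T\mathcal{B}_2(F)$.** It is the $\mathbb{Z}$-module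 generated by the elements $\langle a;a']:=[a+a'\varepsilon]-[a]\in\mathbb{Z}[F[\varepsilon]_2]$ ($a,a'\in F$, $a\ne0,1$) modulo the five-term relations $$\langle a;a']-\langle b;b']+\Big\langle\tfrac ba;\big(\tfrac ba\big)'\Big]-\Big\langle\tfrac{1-b}{1-a};\big(\tfrac{1-b}{1-a}\big)'\Big]+\Big\langle\tfrac{a(1-b)}{b(1-a)};\big(\tfrac{a(1-b)}{b(1-a)}\big)'\Big]=0,\qquad a,b\neq0,1,\ a\neq b,$$ with $\big(\tfrac ba\big)'=\tfrac{ab'-a'b}{a^2}$, $\big(\tfrac{1-b}{1-a}\big)'=\tfrac{(1-b)a'-(1-a)b'}{(1-a)^2}$, $\big(\tfrac{a(1-b)}{b(1-a)}\big)'=\tfrac{b(1-b)a'-a(1-a)b'}{(b(1-a))^2}$. The class of $\langle a;b]$ is written $\langle a;b]_2$. -}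

module Defs where

open import Algebra.Apartness.Bundles using (HeytingField; HeytingCommutativeRing)
open import Algebra.Bundles using (AbelianGroup; CommutativeRing; RawRing)
open import Data.Fin.Base using (Fin; zero; suc; punchIn)
open import Data.Fin.Patterns using (0F; 1F; 2F; 3F)
open import Data.Fin.Properties using (punchIn-injective; punchInᵢ≢i)
open import Data.List.Base using ([]; _∷_)
open import Data.List.Relation.Unary.All using ([]; _∷_)
open import Data.List.Relation.Unary.AllPairs using ([]; _∷_)
open import Data.List.Relation.Unary.Unique.Propositional using (Unique)
open import Data.Maybe.Base using (Maybe; just; nothing)
open import Data.Nat.Base as ℕ using (ℕ; zero; suc)
import Data.Nat.Properties as ℕₚ
open import Data.Product.Base using (_,_; proj₁; proj₂; ∃; ∃-syntax) renaming (_×_ to _∧_)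
open import Data.Vec.Functional using (Vector)
open import Function.Base using (_∘_)
open import Level using (_⊔_)
open import Relation.Binary.Bundles using (Setoid)
open import Relation.Binary.PropositionalEquality.Core as ≡ using (_≡_; _≢_)
open import Relation.Nullary using (yes; no)
open import Relation.Unary using (Pred)
import Algebra.Apartness.Properties.HeytingCommutativeRing as HCRProperties
import Algebra.Definitions as Definitions
import Algebra.Definitions.RawMonoid as RawMonoidDefinitions
import Algebra.Module.Construct.Idealization as Idealization
import Algebra.Module.Construct.TensorUnit as TensorUnit
import Algebra.Properties.AbelianGroup as AbelianGroupProperties
import Algebra.Properties.Ring as RingProperties
import Algebra.Properties.Semiring.Mult as SemiringMult
import Algebra.Solver.Ring as RingSolver
import Algebra.Solver.Ring.AlmostCommutativeRing as ACR
import Algebra.Solver.Ring.NaturalCoefficients.Default as NatSolver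
import Relation.Binary.Reasoning.Setoid as ≈-Reasoning

-- A ring solver for an arbitrary commutative ring.  The coefficients are
-- integers, presented as formal differences (p , n) of natural numbers.

module IntegerRingSolver {c ℓ} (R : CommutativeRing c ℓ) where
  open CommutativeRing R
  open SemiringMult semiring using (_×_; ×-homo-+; ×1-homo-*; ×-congˡ)
  open RingProperties ring using (-‿distribˡ-*; -‿distribʳ-*; -0#≈0#)
  open AbelianGroupProperties +-abelianGroup using (⁻¹-∙-comm; ⁻¹-involutive)
  open ≈-Reasoning setoid

  private
    Coeff : Set
    Coeff = ℕ ∧ ℕ

    ⟦_⟧ : Coeff → Carrier
    ⟦ p , n ⟧ = p × 1# - n × 1#

    rawCoeff : RawRing _ _
    rawCoeff = record
      { Carrier = Coeff
      ; _≈_ = _≡_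
      ; _+_ = λ { (p , n) (q , m) → p ℕ.+ q , n ℕ.+ m }
      ; _*_ = λ { (p , n) (q , m) → p ℕ.* q ℕ.+ n ℕ.* m , p ℕ.* m ℕ.+ n ℕ.* q }
      ; -_ = λ { (p , n) → n , p }
      ; 0# = 0 , 0
      ; 1# = 1 , 0
      }

    module C = RawRing rawCoeff

    almostCommutativeRing : ACR.AlmostCommutativeRing c ℓ
    almostCommutativeRing = ACR.fromCommutativeRing R

    sum-of-differences : ∀ a b c d → (a + b) - (c + d) ≈ (a - c) + (b - d)
    sum-of-differences a b c d = begin
      (a + b) - (c + d)      ≈⟨ +-congˡ (⁻¹-∙-comm c d) ⟨
      (a + b) + (- c + - d)  ≈⟨ solve 4 (λ a b c d → (a :+ b) :+ (c :+ d) := (a :+ c) :+ (b :+ d)) refl a b (- c) (- d) ⟩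
      (a - c) + (b - d)      ∎
      where open NatSolver commutativeSemiring

    product-of-differences : ∀ a b c d →
      (a * b + c * d) - (a * d + c * b) ≈ (a - c) * (b - d)
    product-of-differences a b c d = begin
      (a * b + c * d) - (a * d + c * b)
        ≈⟨ +-cong (+-congˡ (⁻¹-involutive (c * d))) (⁻¹-∙-comm (a * d) (c * b)) ⟨
      (a * b + - - (c * d)) + (- (a * d) + - (c * b))
        ≈⟨ +-cong (+-congˡ (trans (-‿cong (-‿distribˡ-* c d)) (-‿distribʳ-* (- c) d)))
                  (+-cong (-‿distribʳ-* a d) (-‿distribˡ-* c b)) ⟩
      (a * b + - c * - d) + (a * - d + - c * b)
        ≈⟨ solve 4 (λ a b c d → (a :* b :+ c :* d) :+ (a :* d :+ c :* b) := (a :+ c) :* (b :+ d)) refl a b (- c) (- d) ⟩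
      (a - c) * (b - d) ∎
      where open NatSolver commutativeSemiring

    swap-difference : ∀ a b → a - b ≈ - (b - a)
    swap-difference a b = begin
      a - b        ≈⟨ +-comm a (- b) ⟩
      - b + a      ≈⟨ +-congˡ (⁻¹-involutive a) ⟨
      - b + - - a  ≈⟨ ⁻¹-∙-comm b (- a) ⟩
      - (b - a)    ∎

    ×-homo-dot : ∀ p q n m → (p ℕ.* q ℕ.+ n ℕ.* m) × 1# ≈
                 (p × 1#) * (q × 1#) + (n × 1#) * (m × 1#)
    ×-homo-dot p q n m =
      trans (×-homo-+ 1# (p ℕ.* q) (n ℕ.* m)) (+-cong (×1-homo-* p q) (×1-homo-* n m))

    morphism : rawCoeff ACR.-Raw-AlmostCommutative⟶ almostCommutativeRing
    morphism = record
      { ⟦_⟧ = ⟦_⟧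
      ; +-homo = λ { (p , n) (q , m) →
          trans (+-cong (×-homo-+ 1# p q) (-‿cong (×-homo-+ 1# n m)))
                (sum-of-differences _ _ _ _) }
      ; *-homo = λ { (p , n) (q , m) →
          trans (+-cong (×-homo-dot p q n m) (-‿cong (×-homo-dot p m n q)))
                (product-of-differences _ _ _ _) }
      ; -‿homo = λ { (p , n) → swap-difference _ _ }
      ; 0-homo = -‿inverseʳ 0#
      ; 1-homo = trans (+-cong (+-identityʳ 1#) -0#≈0#) (+-identityʳ 1#)
      }

    _≟ᶜ_ : ∀ x y → Maybe (⟦ x ⟧ ≈ ⟦ y ⟧)
    (p , n) ≟ᶜ (q , m) with p ℕ.+ m ℕₚ.≟ q ℕ.+ n
    ... | no _   = nothing
    ... | yes eq = just (begin
      p × 1# - n × 1#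
        ≈⟨ cancel _ _ _ ⟨
      (p × 1# + m × 1#) - (n × 1# + m × 1#)
        ≈⟨ +-cong (trans (sym (×-homo-+ 1# p m)) (trans (×-congˡ eq) (×-homo-+ 1# q n)))
                  (-‿cong (+-comm _ _)) ⟩
      (q × 1# + n × 1#) - (m × 1# + n × 1#)
        ≈⟨ cancel _ _ _ ⟩
      q × 1# - m × 1# ∎)
      where
      cancel : ∀ a b c → (a + c) - (b + c) ≈ a - b
      cancel a b c = begin
        (a + c) - (b + c)  ≈⟨ sum-of-differences a c b c ⟩
        (a - b) + (c - c)  ≈⟨ +-congˡ (-‿inverseʳ c) ⟩
        (a - b) + 0#       ≈⟨ +-identityʳ _ ⟩
        a - b              ∎

  open RingSolver rawCoeff almostCommutativeRing morphism _≟ᶜ_ public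

module Determinant {c ℓ} (R : CommutativeRing c ℓ) where
  open CommutativeRing R

  Δ : (u v w : Vector Carrier 3) → Carrier
  Δ u v w =
      u 0F * (v 1F * w 2F - v 2F * w 1F)
    - u 1F * (v 0F * w 2F - v 2F * w 0F)
    + u 2F * (v 0F * w 1F - v 1F * w 0F)

  plücker : ∀ p a b c d →
    Δ p a c * Δ p b d - Δ p a d * Δ p b c ≈ Δ p a b * Δ p c d
  plücker p a b c d = solve 15
    (λ p₀ p₁ p₂ a₀ a₁ a₂ b₀ b₁ b₂ c₀ c₁ c₂ d₀ d₁ d₂ →
      let D = λ u₀ u₁ u₂ v₀ v₁ v₂ w₀ w₁ w₂ →
                u₀ :* (v₁ :* w₂ :- v₂ :* w₁) :- u₁ :* (v₀ :* w₂ :- v₂ :* w₀)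
                  :+ u₂ :* (v₀ :* w₁ :- v₁ :* w₀)
      in D p₀ p₁ p₂ a₀ a₁ a₂ c₀ c₁ c₂ :* D p₀ p₁ p₂ b₀ b₁ b₂ d₀ d₁ d₂
           :- D p₀ p₁ p₂ a₀ a₁ a₂ d₀ d₁ d₂ :* D p₀ p₁ p₂ b₀ b₁ b₂ c₀ c₁ c₂
         := D p₀ p₁ p₂ a₀ a₁ a₂ b₀ b₁ b₂ :* D p₀ p₁ p₂ c₀ c₁ c₂ d₀ d₁ d₂)
    refl
    (p 0F) (p 1F) (p 2F) (a 0F) (a 1F) (a 2F) (b 0F) (b 1F) (b 2F)
    (c 0F) (c 1F) (c 2F) (d 0F) (d 1F) (d 2F)
    where open IntegerRingSolver R

-- ℤ[S] for a setoid S: ℤ-linear combinations of elements of S, presented as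
-- terms modulo the congruence generated by the abelian group laws.
module FreeAbelianGroup {c ℓ} (S : Setoid c ℓ) where
  open Setoid S using () renaming (Carrier to X; _≈_ to _≈ˣ_)

  infix  8 -_
  infixl 6 _+_
  infix  4 _≈_

  data Combination : Set c where
    [_] : X → Combination
    0#  : Combination
    _+_ : Combination → Combination → Combination
    -_  : Combination → Combination

  data _≈_ : Combination → Combination → Set (c ⊔ ℓ) where
    refl        : ∀ {x} → x ≈ x
    sym         : ∀ {x y} → x ≈ y → y ≈ x
    trans       : ∀ {x y z} → x ≈ y → y ≈ z → x ≈ z
    []-cong     : ∀ {s t} → s ≈ˣ t → [ s ] ≈ [ t ]
    +-cong      : ∀ {x y u v} → x ≈ y → u ≈ v → x + u ≈ y + v
    -‿cong      : ∀ {x y} → x ≈ y → - x ≈ - y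
    +-assoc     : ∀ x y z → (x + y) + z ≈ x + (y + z)
    +-comm      : ∀ x y → x + y ≈ y + x
    +-identityˡ : ∀ x → 0# + x ≈ x
    -‿inverseˡ  : ∀ x → - x + x ≈ 0#

  abelianGroup : AbelianGroup c (c ⊔ ℓ)
  abelianGroup = record
    { Carrier = Combination
    ; _≈_ = _≈_
    ; _∙_ = _+_
    ; ε = 0#
    ; _⁻¹ = -_
    ; isAbelianGroup = record
      { isGroup = record
        { isMonoid = record
          { isSemigroup = record
            { isMagma = record
              { isEquivalence = record { refl = refl ; sym = sym ; trans = trans }
              ; ∙-cong = +-cong
              }
            ; assoc = +-assoc
            }
          ; identity = +-identityˡ , λ x → trans (+-comm x 0#) (+-identityˡ x)
          }
        ; inverse = -‿inverseˡ , λ x → trans (+-comm x (- x)) (-‿inverseˡ x)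
        ; ⁻¹-cong = -‿cong
        }
      ; comm = +-comm
      }
    }

module _ {c ℓ} (A : AbelianGroup c ℓ) where
  open AbelianGroup A
  open AbelianGroupProperties A using (⁻¹-∙-comm; ⁻¹-involutive; ε⁻¹≈ε)

  data Span {p} (P : Pred Carrier p) : Pred Carrier (c ⊔ ℓ ⊔ p) where
    generator : ∀ {x} → P x → Span P x
    ε-closed  : Span P ε
    ∙-closed  : ∀ {x y} → Span P x → Span P y → Span P (x ∙ y)
    ⁻¹-closed : ∀ {x} → Span P x → Span P (x ⁻¹)
    resp-≈    : ∀ {x y} → x ≈ y → Span P x → Span P y

  Generated : ∀ {p} → Pred Carrier p → AbelianGroup (c ⊔ ℓ ⊔ p) ℓ
  Generated P = record
    { Carrier = ∃ (Span P)
    ; _≈_ = λ x y → proj₁ x ≈ proj₁ y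
    ; _∙_ = λ { (x , sx) (y , sy) → x ∙ y , ∙-closed sx sy }
    ; ε = ε , ε-closed
    ; _⁻¹ = λ { (x , sx) → x ⁻¹ , ⁻¹-closed sx }
    ; isAbelianGroup = record
      { isGroup = record
        { isMonoid = record
          { isSemigroup = record
            { isMagma = record
              { isEquivalence = record { refl = refl ; sym = sym ; trans = trans }
              ; ∙-cong = ∙-cong
              }
            ; assoc = λ x y z → assoc _ _ _
            }
          ; identity = (λ x → identityˡ _) , (λ x → identityʳ _)
          }
        ; inverse = (λ x → inverseˡ _) , (λ x → inverseʳ _)
        ; ⁻¹-cong = ⁻¹-cong
        }
      ; comm = λ x y → comm _ _
      }
    }

  -- Same elements as A; x and y are identified when x - y lies in the
  -- subgroup spanned by R.
  Quotient : ∀ {p} → Pred Carrier p → AbelianGroup c (c ⊔ ℓ ⊔ p)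
  Quotient R = record
    { Carrier = Carrier
    ; _≈_ = _∼_
    ; _∙_ = _∙_
    ; ε = ε
    ; _⁻¹ = _⁻¹
    ; isAbelianGroup = record
      { isGroup = record
        { isMonoid = record
          { isSemigroup = record
            { isMagma = record
              { isEquivalence = record
                { refl = ≈⇒∼ refl ; sym = ∼-sym ; trans = ∼-trans }
              ; ∙-cong = ∼-cong
              }
            ; assoc = λ x y z → ≈⇒∼ (assoc x y z)
            }
          ; identity = (λ x → ≈⇒∼ (identityˡ x)) , (λ x → ≈⇒∼ (identityʳ x))
          }
        ; inverse = (λ x → ≈⇒∼ (inverseˡ x)) , (λ x → ≈⇒∼ (inverseʳ x))
        ; ⁻¹-cong = λ {x} {y} s →
            resp-≈ (sym (⁻¹-∙-comm x (y ⁻¹))) (⁻¹-closed s)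
        }
      ; comm = λ x y → ≈⇒∼ (comm x y)
      }
    }
    where
    open ≈-Reasoning setoid

    _∼_ : Carrier → Carrier → Set _
    x ∼ y = Span R (x - y)

    ≈⇒∼ : ∀ {x y} → x ≈ y → x ∼ y
    ≈⇒∼ {x} {y} x≈y = resp-≈ (trans (sym (inverseʳ y)) (∙-congʳ (sym x≈y))) ε-closed

    ∼-sym : ∀ {x y} → x ∼ y → y ∼ x
    ∼-sym {x} {y} s = resp-≈ (begin
      (x ∙ y ⁻¹) ⁻¹       ≈⟨ ⁻¹-∙-comm x (y ⁻¹) ⟨
      x ⁻¹ ∙ (y ⁻¹) ⁻¹    ≈⟨ ∙-congˡ (⁻¹-involutive y) ⟩
      x ⁻¹ ∙ y            ≈⟨ comm _ _ ⟩
      y ∙ x ⁻¹            ∎) (⁻¹-closed s)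

    ∼-trans : ∀ {x y z} → x ∼ y → y ∼ z → x ∼ z
    ∼-trans {x} {y} {z} s t = resp-≈ (begin
      (x ∙ y ⁻¹) ∙ (y ∙ z ⁻¹)  ≈⟨ assoc x (y ⁻¹) _ ⟩
      x ∙ (y ⁻¹ ∙ (y ∙ z ⁻¹))  ≈⟨ ∙-congˡ (assoc (y ⁻¹) y _) ⟨
      x ∙ ((y ⁻¹ ∙ y) ∙ z ⁻¹)  ≈⟨ ∙-congˡ (∙-congʳ (inverseˡ y)) ⟩
      x ∙ (ε ∙ z ⁻¹)           ≈⟨ ∙-congˡ (identityˡ _) ⟩
      x ∙ z ⁻¹                 ∎) (∙-closed s t)

    ∼-cong : ∀ {x y u v} → x ∼ y → u ∼ v → (x ∙ u) ∼ (y ∙ v)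
    ∼-cong {x} {y} {u} {v} s t = resp-≈ (begin
      (x ∙ y ⁻¹) ∙ (u ∙ v ⁻¹)  ≈⟨ assoc x (y ⁻¹) _ ⟩
      x ∙ (y ⁻¹ ∙ (u ∙ v ⁻¹))  ≈⟨ ∙-congˡ (assoc (y ⁻¹) u _) ⟨
      x ∙ ((y ⁻¹ ∙ u) ∙ v ⁻¹)  ≈⟨ ∙-congˡ (∙-congʳ (comm (y ⁻¹) u)) ⟩
      x ∙ ((u ∙ y ⁻¹) ∙ v ⁻¹)  ≈⟨ ∙-congˡ (assoc u (y ⁻¹) _) ⟩
      x ∙ (u ∙ (y ⁻¹ ∙ v ⁻¹))  ≈⟨ assoc x u _ ⟨
      (x ∙ u) ∙ (y ⁻¹ ∙ v ⁻¹)  ≈⟨ ∙-congˡ (⁻¹-∙-comm y v) ⟩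
      (x ∙ u) ∙ (y ∙ v) ⁻¹     ∎) (∙-closed s t)

  -- (-1)ⁿ x
  signed : ℕ → Carrier → Carrier
  signed zero    x = x
  signed (suc n) x = signed n x ⁻¹

-- A field is rendered as a HeytingField: its tight apartness x # y plays
-- the role of x ≠ y, and being apart from 0# is being invertible.

module OverField {c ℓ₁ ℓ₂} (F : HeytingField c ℓ₁ ℓ₂) where
  open HeytingField F
  open HeytingCommutativeRing heytingCommutativeRing using (commutativeRing)
  open CommutativeRing commutativeRing using (ring; +-rawMonoid)
  open HCRProperties heytingCommutativeRing
    using (x-0≈x; x#0y#0→xy#0; #-congʳ; invertibleˡ⇒#)
  open RawMonoidDefinitions +-rawMonoid using () renaming (_×_ to _·ℕ_)

  private
    open IntegerRingSolver commutativeRing using (solve; _:=_; _:+_; _:*_; _:-_; :-_)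
    open ≈-Reasoning setoid

  CharacteristicZero : Set ℓ₂
  CharacteristicZero = ∀ n → (suc n ·ℕ 1#) # 0#

  infixl 7 _/_⟨_⟩
  infix  9 _⁻¹⟨_⟩

  _⁻¹⟨_⟩ : ∀ y → y # 0# → Carrier
  y ⁻¹⟨ y#0 ⟩ = proj₁ (#⇒invertible y#0)

  _/_⟨_⟩ : Carrier → ∀ y → y # 0# → Carrier
  x / y ⟨ y#0 ⟩ = x * y ⁻¹⟨ y#0 ⟩

  ⁻¹-inverseˡ : ∀ {y} (y#0 : y # 0#) → y ⁻¹⟨ y#0 ⟩ * y ≈ 1#
  ⁻¹-inverseˡ {y} y#0 =
    trans (*-congˡ (sym (x-0≈x y))) (proj₁ (proj₂ (#⇒invertible y#0)))

  ⁻¹-inverseʳ : ∀ {y} (y#0 : y # 0#) → y * y ⁻¹⟨ y#0 ⟩ ≈ 1#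
  ⁻¹-inverseʳ y#0 = trans (*-comm _ _) (⁻¹-inverseˡ y#0)

  ⁻¹#0 : ∀ {y} (y#0 : y # 0#) → y ⁻¹⟨ y#0 ⟩ # 0#
  ⁻¹#0 {y} y#0 = invertibleˡ⇒#
    (y , trans (*-congˡ (x-0≈x _)) (⁻¹-inverseʳ y#0))

  x-y#0⇒x#y : ∀ {x y} → x - y # 0# → x # y
  x-y#0⇒x#y {x} {y} d#0 = invertibleˡ⇒# ((x - y) ⁻¹⟨ d#0 ⟩ , ⁻¹-inverseˡ d#0)

  x#y⇒x-y#0 : ∀ {x y} → x # y → x - y # 0#
  x#y⇒x-y#0 {x} {y} x#y with #⇒invertible x#y
  ... | z , z*[x-y]≈1 , _ = invertibleˡ⇒# (z , trans (*-congˡ (x-0≈x _)) z*[x-y]≈1)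

  x/y#0 : ∀ {x y} → x # 0# → (y#0 : y # 0#) → x / y ⟨ y#0 ⟩ # 0#
  x/y#0 x#0 y#0 = x#0y#0→xy#0 x#0 (⁻¹#0 y#0)

  x/y#1 : ∀ {x y} → x # y → (y#0 : y # 0#) → x / y ⟨ y#0 ⟩ # 1#
  x/y#1 {x} {y} x#y y#0 =
    x-y#0⇒x#y (#-congʳ [x-y]/y≈x/y-1 (x/y#0 (x#y⇒x-y#0 x#y) y#0))
    where
    y⁻¹ = y ⁻¹⟨ y#0 ⟩

    [x-y]/y≈x/y-1 : (x - y) * y⁻¹ ≈ x * y⁻¹ - 1#
    [x-y]/y≈x/y-1 = begin
      (x - y) * y⁻¹        ≈⟨ solve 3 (λ x y z → (x :- y) :* z := x :* z :- y :* z) refl x y y⁻¹ ⟩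
      x * y⁻¹ - y * y⁻¹    ≈⟨ +-congˡ (-‿cong (⁻¹-inverseʳ y#0)) ⟩
      x * y⁻¹ - 1#         ∎

  -- F[ε]₂, as the idealization of F over itself: (a , a′) stands for a + a′ε
  -- and (a , a′) * (b , b′) = (ab , ab′ + a′b).

  private
    module Dual = Idealization ring TensorUnit.bimodule

  dualNumbers : CommutativeRing c ℓ₁
  dualNumbers = record
    { isCommutativeRing = record
      { isRing = Dual.isRingᴺ
      ; *-comm = λ { (a , a′) (b , b′) → *-comm a b ,
          trans (+-comm _ _) (+-cong (*-comm a′ b) (*-comm a b′)) }
      }
    }

  module F[ε] = CommutativeRing dualNumbers

  ε-invertible : ∀ z → proj₁ z # 0# →
    Definitions.Invertible F[ε]._≈_ F[ε].1# F[ε]._*_ z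
  ε-invertible z@(a , a′) a#0 = z⁻¹ , F[ε].trans (F[ε].*-comm z⁻¹ z) z*z⁻¹≈1 , z*z⁻¹≈1
    where
    u = a ⁻¹⟨ a#0 ⟩
    z⁻¹ = u , - (u * u * a′)

    z*z⁻¹≈1 : z F[ε].* z⁻¹ F[ε].≈ F[ε].1#
    z*z⁻¹≈1 = ⁻¹-inverseʳ a#0 , (begin
      a * - (u * u * a′) + a′ * u
        ≈⟨ solve 3 (λ a a′ u → a :* (:- (u :* u :* a′)) :+ a′ :* u
                            := a′ :* u :- (a :* u) :* (u :* a′)) refl a a′ u ⟩
      a′ * u - (a * u) * (u * a′)
        ≈⟨ +-congˡ (-‿cong (trans (*-congʳ (⁻¹-inverseʳ a#0)) (*-identityˡ _))) ⟩
      a′ * u - u * a′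
        ≈⟨ +-congˡ (-‿cong (*-comm u a′)) ⟩
      a′ * u - a′ * u
        ≈⟨ -‿inverseʳ _ ⟩
      0# ∎)

  open Determinant dualNumbers public using (Δ)
  open Determinant commutativeRing public using (plücker) renaming (Δ to Δ₀)

  -- A point of ℙ² over F[ε]₂ is given by a representing vector x + x′ε with
  -- x ≠ 0; rescaling it by a unit changes neither genericity nor the
  -- cross-ratios below.
  record Point : Set (c ⊔ ℓ₂) where
    field
      vector : Vector F[ε].Carrier 3

    reduced : Vector Carrier 3
    reduced = proj₁ ∘ vector

    field
      nonzero : ∃[ k ] reduced k # 0#

  open Point public

  GenericPosition : ∀ {n} → (Fin n → Point) → Set ℓ₂
  GenericPosition x = ∀ {i j k} → i ≢ j → i ≢ k → j ≢ k →
    Δ₀ (reduced (x i)) (reduced (x j)) (reduced (x k)) # 0#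

  module CrossRatio {n} (x : Fin n → Point) (generic : GenericPosition x) where

    D : Fin n → Fin n → Fin n → F[ε].Carrier
    D i j k = Δ (vector (x i)) (vector (x j)) (vector (x k))

    D₀ : Fin n → Fin n → Fin n → Carrier
    D₀ i j k = Δ₀ (reduced (x i)) (reduced (x j)) (reduced (x k))

    Distinct : (i j k l m : Fin n) → Set
    Distinct i j k l m = Unique (i ∷ j ∷ k ∷ l ∷ m ∷ [])

    denominator#0 : ∀ i j k l m → Distinct i j k l m → D₀ i j l * D₀ i k m # 0#
    denominator#0 _ _ _ _ _
      ((ij ∷ ik ∷ il ∷ im ∷ []) ∷ (jk ∷ jl ∷ jm ∷ []) ∷ (kl ∷ km ∷ []) ∷ _) =
      x#0y#0→xy#0 (generic ij il jl) (generic ik im km)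

    -- 𝐫(x*ᵢ | x*ⱼ , x*ₖ , x*ₗ , x*ₘ) ∈ F[ε]₂
    𝐫 : ∀ i j k l m → Distinct i j k l m → F[ε].Carrier
    𝐫 i j k l m d = (D i j m F[ε].* D i k l)
      F[ε].* proj₁ (ε-invertible (D i j l F[ε].* D i k m) (denominator#0 i j k l m d))

    r rε : ∀ i j k l m → Distinct i j k l m → Carrier
    r  i j k l m d = proj₁ (𝐫 i j k l m d)
    rε i j k l m d = proj₂ (𝐫 i j k l m d)

    r#0 : ∀ i j k l m (d : Distinct i j k l m) → r i j k l m d # 0#
    r#0 i j k l m
      d@((ij ∷ ik ∷ il ∷ im ∷ []) ∷ (jk ∷ jl ∷ jm ∷ []) ∷ (kl ∷ km ∷ []) ∷ _) =
      x/y#0 (x#0y#0→xy#0 (generic ij im jm) (generic ik il kl))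
            (denominator#0 i j k l m d)

    r#1 : ∀ i j k l m (d : Distinct i j k l m) → r i j k l m d # 1#
    r#1 i j k l m
      d@((ij ∷ ik ∷ il ∷ im ∷ []) ∷ (jk ∷ jl ∷ jm ∷ []) ∷ (kl ∷ km ∷ []) ∷ (lm ∷ []) ∷ _) =
      x/y#1 (#-sym (x-y#0⇒x#y (#-congʳ (sym (plücker (v i) (v j) (v k) (v l) (v m)))
              (x#0y#0→xy#0 (generic ij ik jk) (generic il im lm)))))
            (denominator#0 i j k l m d)
      where v = reduced ∘ x

  module ℤ[F[ε]] = FreeAbelianGroup F[ε].setoid

  data Generator : Pred ℤ[F[ε]].Combination (c ⊔ ℓ₂) where
    mk : ∀ a a′ → a # 0# → a # 1# →
         Generator (ℤ[F[ε]].[ a , a′ ] ℤ[F[ε]].+ (ℤ[F[ε]].- ℤ[F[ε]].[ a , 0# ]))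

  generated : AbelianGroup (c ⊔ ℓ₁ ⊔ ℓ₂) (c ⊔ ℓ₁)
  generated = Generated ℤ[F[ε]].abelianGroup Generator

  -- ⟨ a ; a′ ], carrying evidence that a ≠ 0 and a ≠ 1.  (A semicolon is
  -- reserved by Agda's lexer.)
  ⟨_⨟_∣_∣_] : ∀ a (a′ : Carrier) → a # 0# → a # 1# → AbelianGroup.Carrier generated
  ⟨ a ⨟ a′ ∣ a#0 ∣ a#1 ] = _ , generator (mk a a′ a#0 a#1)

  x#1⇒1-x#0 : ∀ {x} → x # 1# → 1# - x # 0#
  x#1⇒1-x#0 x#1 = x#y⇒x-y#0 (#-sym x#1)

  module FiveTermArguments (a b : Carrier)
    (a#0 : a # 0#) (a#1 : a # 1#) (b#0 : b # 0#) (b#1 : b # 1#) (a#b : a # b)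
    where

    1-a#0 : 1# - a # 0#
    1-a#0 = x#1⇒1-x#0 a#1

    1-b#0 : 1# - b # 0#
    1-b#0 = x#1⇒1-x#0 b#1

    b[1-a]#0 : b * (1# - a) # 0#
    b[1-a]#0 = x#0y#0→xy#0 b#0 1-a#0

    a[1-b]#0 : a * (1# - b) # 0#
    a[1-b]#0 = x#0y#0→xy#0 a#0 1-b#0

    1-b#1-a : 1# - b # 1# - a
    1-b#1-a = x-y#0⇒x#y (#-congʳ
      (solve 3 (λ o a b → a :- b := (o :- b) :- (o :- a)) refl 1# a b)
      (x#y⇒x-y#0 a#b))

    a[1-b]#b[1-a] : a * (1# - b) # b * (1# - a)
    a[1-b]#b[1-a] = x-y#0⇒x#y (#-congʳ (begin
      a - b
        ≈⟨ +-cong (*-identityʳ a) (-‿cong (*-identityʳ b)) ⟨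
      a * 1# - b * 1#
        ≈⟨ solve 3 (λ o a b → a :* o :- b :* o := a :* (o :- b) :- b :* (o :- a)) refl 1# a b ⟩
      a * (1# - b) - b * (1# - a) ∎)
      (x#y⇒x-y#0 a#b))

    a²#0 : a * a # 0#
    a²#0 = x#0y#0→xy#0 a#0 a#0

    [1-a]²#0 : (1# - a) * (1# - a) # 0#
    [1-a]²#0 = x#0y#0→xy#0 1-a#0 1-a#0

    [b[1-a]]²#0 : (b * (1# - a)) * (b * (1# - a)) # 0#
    [b[1-a]]²#0 = x#0y#0→xy#0 b[1-a]#0 b[1-a]#0

  -- The left-hand sides of the five-term relations.
  data FiveTerm : Pred (AbelianGroup.Carrier generated) (c ⊔ ℓ₂) where
    fiveTerm : ∀ a a′ b b′ (a#0 : a # 0#) (a#1 : a # 1#)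
      (b#0 : b # 0#) (b#1 : b # 1#) (a#b : a # b) →
      let open AbelianGroup generated using () renaming (_∙_ to infixl 6 _⊕_; _-_ to infixl 6 _⊖_)
          open FiveTermArguments a b a#0 a#1 b#0 b#1 a#b
      in FiveTerm
        ( ⟨ a ⨟ a′ ∣ a#0 ∣ a#1 ]
        ⊖ ⟨ b ⨟ b′ ∣ b#0 ∣ b#1 ]
        ⊕ ⟨ b / a ⟨ a#0 ⟩
          ⨟ (a * b′ - a′ * b) / (a * a) ⟨ a²#0 ⟩
          ∣ x/y#0 b#0 a#0 ∣ x/y#1 (#-sym a#b) a#0 ]
        ⊖ ⟨ (1# - b) / (1# - a) ⟨ 1-a#0 ⟩
          ⨟ ((1# - b) * a′ - (1# - a) * b′) / ((1# - a) * (1# - a)) ⟨ [1-a]²#0 ⟩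
          ∣ x/y#0 1-b#0 1-a#0 ∣ x/y#1 1-b#1-a 1-a#0 ]
        ⊕ ⟨ (a * (1# - b)) / (b * (1# - a)) ⟨ b[1-a]#0 ⟩
          ⨟ (b * (1# - b) * a′ - a * (1# - a) * b′)
              / ((b * (1# - a)) * (b * (1# - a))) ⟨ [b[1-a]]²#0 ⟩
          ∣ x/y#0 a[1-b]#0 b[1-a]#0 ∣ x/y#1 a[1-b]#b[1-a] b[1-a]#0 ] )

  T𝓑₂ : AbelianGroup (c ⊔ ℓ₁ ⊔ ℓ₂) (c ⊔ ℓ₁ ⊔ ℓ₂)
  T𝓑₂ = Quotient generated FiveTerm

  ⟨_⨟_∣_∣_]₂ : ∀ a (a′ : Carrier) → a # 0# → a # 1# → AbelianGroup.Carrier T𝓑₂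
  ⟨ a ⨟ a′ ∣ a#0 ∣ a#1 ]₂ = ⟨ a ⨟ a′ ∣ a#0 ∣ a#1 ]

punchIn-distinct : (i : Fin 5) →
  Unique (i ∷ punchIn i 0F ∷ punchIn i 1F ∷ punchIn i 2F ∷ punchIn i 3F ∷ [])
punchIn-distinct i =
    (out 0F ∷ out 1F ∷ out 2F ∷ out 3F ∷ [])
  ∷ (inj (λ ()) ∷ inj (λ ()) ∷ inj (λ ()) ∷ [])
  ∷ (inj (λ ()) ∷ inj (λ ()) ∷ [])
  ∷ (inj (λ ()) ∷ [])
  ∷ []
  ∷ []
  where
  out : ∀ j → i ≢ punchIn i j
  out j = punchInᵢ≢i i j ∘ ≡.sym

  inj : ∀ {j k} → j ≢ k → punchIn i j ≢ punchIn i k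
  inj j≢k = j≢k ∘ punchIn-injective i _ _

-- Over F[ε]₂ the cross-ratios satisfy r₁ = r₂r₀, r₃ = r₄r₂ and
-- 1 - r₀ = r₄(1 - r₁), the last by the Plücker relation.  Hence the five-term
-- relation at (r₀ , r₁) reads ⟨r₀] - ⟨r₁] + ⟨r₂] - ⟨1/r₄] + ⟨1/r₃] = 0, and the
-- claim follows from the inversion relation ⟨z] + ⟨1/z] = 0.
--
-- For the latter put f(z) = ⟨z] + ⟨1/z].  Adding the five-term relations at
-- (a , b) and (b , a) gives f(cd) = f(c) + f(d); since also f(1/z) = f(z), this
-- yields 2f = 0.  Moreover f vanishes on elements with zero ε-part.  Halve the
-- logarithmic derivative: for z = z₀ + z′ε and w = c(1 + (z′/2z₀)ε), we have
-- z = w·(z/w) and w = (w²/z)·(z/w) with w²/z free of ε, so f(z) = 2f(w) = 0.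

module Submission where

open import Defs
open import Algebra.Apartness.Bundles using (HeytingField; HeytingCommutativeRing)
open import Algebra.Bundles using (AbelianGroup; CommutativeRing)
open import Data.Fin.Base using (Fin; toℕ; punchIn)
open import Data.Fin.Patterns using (0F; 1F; 2F; 3F; 4F)
open import Data.Nat.Base as ℕ using (ℕ; suc)
open import Data.Product.Base using (_,_; proj₁; proj₂; ∃) renaming (_×_ to _∧_)
open import Data.Sum.Base using (_⊎_; inj₁; inj₂; [_,_]′)
open import Data.Vec.Functional using (Vector)
open import Function.Base using (_∘_)
open import Level using (_⊔_)
open import Relation.Binary.Bundles using (ApartnessRelation)
open import Relation.Binary.PropositionalEquality.Core using (_≢_)
open import Relation.Unary using (Pred)
import Algebra.Apartness.Properties.HeytingCommutativeRing as HCRProperties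
import Algebra.Properties.AbelianGroup as AbelianGroupProperties
import Algebra.Properties.CommutativeMonoid.Sum as Sum
import Algebra.Properties.Semiring.Mult as SemiringMult
import Algebra.Solver.CommutativeMonoid as CommutativeMonoidSolver
import Relation.Binary.Reasoning.Setoid as ≈-Reasoning

-- Rearranging five-term relations in an abelian group.

module AbelianGroupLemmas {a ℓ} (A : AbelianGroup a ℓ) where
  open AbelianGroup A
  open AbelianGroupProperties A using (∙-cancelˡ; ∙-cancelʳ; ⁻¹-involutive; ε⁻¹≈ε)
  open CommutativeMonoidSolver commutativeMonoid using (solve; _⊕_; _⊜_)
  open ≈-Reasoning setoid

  x∙y≈y⇒x≈ε : ∀ {x y} → x ∙ y ≈ y → x ≈ ε
  x∙y≈y⇒x≈ε {x} {y} e = ∙-cancelʳ y x ε (trans e (sym (identityˡ y)))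

  -- A subtraction-free form: once the negative terms change sides, relations can be added with the
  -- commutative monoid laws alone.
  alternating⇒balanced : ∀ u v w x y w′ x′ y′ →
    ((u - v) ∙ w - x) ∙ y ≈ ε → w′ ≈ w → x′ ≈ x → y′ ≈ y → u ∙ w′ ∙ y′ ≈ v ∙ x′
  alternating⇒balanced u v w x y w′ x′ y′ e w′≈w x′≈x y′≈y = begin
    u ∙ w′ ∙ y′                              ≈⟨ ∙-cong (∙-congˡ w′≈w) y′≈y ⟩
    u ∙ w ∙ y                                ≈⟨ identityʳ _ ⟨
    u ∙ w ∙ y ∙ ε                            ≈⟨ ∙-congˡ (trans (∙-cong (inverseˡ v) (inverseˡ x)) (identityˡ ε)) ⟨
    -- The monoid solver treats inverses as atoms, so `v ⁻¹ ∙ v` and `x ⁻¹ ∙ x` are inserted to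
    -- assemble the left-hand side of `e`.
    u ∙ w ∙ y ∙ (v ⁻¹ ∙ v ∙ (x ⁻¹ ∙ x))
      ≈⟨ solve 7 (λ u v w x y v⁻ x⁻ →
           (((u ⊕ w) ⊕ y) ⊕ ((v⁻ ⊕ v) ⊕ (x⁻ ⊕ x))) ⊜
           (((((u ⊕ v⁻) ⊕ w) ⊕ x⁻) ⊕ y) ⊕ (v ⊕ x))) refl u v w x y (v ⁻¹) (x ⁻¹) ⟩
    ((u - v) ∙ w - x) ∙ y ∙ (v ∙ x)          ≈⟨ ∙-congʳ e ⟩
    ε ∙ (v ∙ x)                              ≈⟨ identityˡ _ ⟩
    v ∙ x                                    ≈⟨ ∙-congˡ x′≈x ⟨
    v ∙ x′                                   ∎

  -- `u` and `v` trade places between the two relations, so both cancel from the sum.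
  add-balanced : ∀ {u v w x y w′ x′ y′} →
    u ∙ w ∙ y ≈ v ∙ x → v ∙ w′ ∙ y′ ≈ u ∙ x′ →
    (w ∙ w′) ∙ (y ∙ y′) ≈ x ∙ x′
  add-balanced {u} {v} {w} {x} {y} {w′} {x′} {y′} e e′ = ∙-cancelˡ (u ∙ v) _ _ (begin
    u ∙ v ∙ (w ∙ w′ ∙ (y ∙ y′))
      ≈⟨ solve 6 (λ u v w w′ y y′ →
           ((u ⊕ v) ⊕ ((w ⊕ w′) ⊕ (y ⊕ y′))) ⊜ (((u ⊕ w) ⊕ y) ⊕ ((v ⊕ w′) ⊕ y′)))
           refl u v w w′ y y′ ⟩
    u ∙ w ∙ y ∙ (v ∙ w′ ∙ y′)    ≈⟨ ∙-cong e e′ ⟩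
    v ∙ x ∙ (u ∙ x′)
      ≈⟨ solve 4 (λ u v x x′ → ((v ⊕ x) ⊕ (u ⊕ x′)) ⊜ ((u ⊕ v) ⊕ (x ⊕ x′))) refl u v x x′ ⟩
    u ∙ v ∙ (x ∙ x′)             ∎)

  -- `x⁻` and `y⁻` play the brackets of inverted arguments. By the inversion relation they are the
  -- negatives of `x` and `y`, which restores the alternating signs.
  balanced⇒signed-sum : ∀ {u v w x y x⁻ y⁻} →
    u ∙ w ∙ x⁻ ≈ v ∙ y⁻ → x ∙ x⁻ ≈ ε → y ∙ y⁻ ≈ ε →
    u ∙ (signed A 1 v ∙ (signed A 2 w ∙ (signed A 3 x ∙ (signed A 4 y ∙ ε)))) ≈ ε
  balanced⇒signed-sum {u} {v} {w} {x} {y} {x⁻} {y⁻} e x∙x⁻≈ε y∙y⁻≈ε = begin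
    u ∙ (v ⁻¹ ∙ (w ⁻¹ ⁻¹ ∙ (x ⁻¹ ⁻¹ ⁻¹ ∙ (y ⁻¹ ⁻¹ ⁻¹ ⁻¹ ∙ ε))))
      ≈⟨ ∙-congˡ (∙-congˡ (∙-cong (⁻¹-involutive w) (∙-cong x⁻¹⁻¹⁻¹≈x⁻
           (trans (identityʳ _) (trans (⁻¹-involutive _) (⁻¹-involutive y)))))) ⟩
    u ∙ (v ⁻¹ ∙ (w ∙ (x⁻ ∙ y)))
      ≈⟨ solve 5 (λ u v⁻ w x⁻ y → (u ⊕ (v⁻ ⊕ (w ⊕ (x⁻ ⊕ y)))) ⊜ (((u ⊕ w) ⊕ x⁻) ⊕ (v⁻ ⊕ y)))
           refl u (v ⁻¹) w x⁻ y ⟩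
    u ∙ w ∙ x⁻ ∙ (v ⁻¹ ∙ y)      ≈⟨ ∙-congʳ e ⟩
    v ∙ y⁻ ∙ (v ⁻¹ ∙ y)
      ≈⟨ solve 4 (λ v v⁻ y y⁻ → ((v ⊕ y⁻) ⊕ (v⁻ ⊕ y)) ⊜ ((v ⊕ v⁻) ⊕ (y ⊕ y⁻)))
           refl v (v ⁻¹) y y⁻ ⟩
    v ∙ v ⁻¹ ∙ (y ∙ y⁻)          ≈⟨ ∙-cong (inverseʳ v) y∙y⁻≈ε ⟩
    ε ∙ ε                        ≈⟨ identityˡ ε ⟩
    ε                            ∎
    where
    x⁻¹⁻¹⁻¹≈x⁻ : x ⁻¹ ⁻¹ ⁻¹ ≈ x⁻
    x⁻¹⁻¹⁻¹≈x⁻ = trans (⁻¹-cong (⁻¹-involutive x))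
      (∙-cancelˡ x _ _ (trans (inverseʳ x) (sym x∙x⁻≈ε)))

  module _ {p} {P : Pred Carrier p} where
    open AbelianGroup (Quotient A P) using () renaming (_≈_ to _∼_)

    -- Elements of T𝓑₂ contain membership proofs that are too large to be
    -- compared by conversion; x ≈ y in the generated group ignores them, so it is
    -- checked after x and y are known.
    respects : ∀ {x y} → Span A P x → x ≈ y → Span A P y
    respects s x≈y = resp-≈ x≈y s

    ≈⇒∼ : ∀ {x y} → x ≈ y → x ∼ y
    ≈⇒∼ {x} {y} e = resp-≈ (trans (sym (inverseʳ y)) (∙-congʳ (sym e))) ε-closed

    relation⇒∼ε : ∀ {x} y → P x → x ≈ y → y ∼ ε
    relation⇒∼ε y h e = resp-≈
      (trans e (trans (sym (identityʳ y)) (∙-congˡ (sym ε⁻¹≈ε)))) (generator h)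

-- Identities between quotients with cleared denominators.

module CommutativeRingLemmas {c ℓ} (R : CommutativeRing c ℓ) where
  open CommutativeRing R
  open IntegerRingSolver R using (solve; _:=_; _:+_; _:*_; _:-_; :-_)
  open Determinant R using (Δ)
  open ≈-Reasoning setoid

  *-cancelʳ-unit : ∀ {x y z w} → z * w ≈ 1# → x * z ≈ y * z → x ≈ y
  *-cancelʳ-unit {x} {y} {z} {w} zw≈1 xz≈yz = begin
    x            ≈⟨ *-identityʳ x ⟨
    x * 1#       ≈⟨ *-congˡ zw≈1 ⟨
    x * (z * w)  ≈⟨ *-assoc x z w ⟨
    x * z * w    ≈⟨ *-congʳ xz≈yz ⟩
    y * z * w    ≈⟨ *-assoc y z w ⟩
    y * (z * w)  ≈⟨ *-congˡ zw≈1 ⟩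
    y * 1#       ≈⟨ *-identityʳ y ⟩
    y            ∎

  x⁻¹xy≈y : ∀ {x x⁻¹} y → x⁻¹ * x ≈ 1# → x⁻¹ * (x * y) ≈ y
  x⁻¹xy≈y y e = trans (sym (*-assoc _ _ y)) (trans (*-congʳ e) (*-identityˡ y))

  x*yz≈yx*z : ∀ x y z → x * (y * z) ≈ y * x * z
  x*yz≈yx*z = solve 3 (λ x y z → x :* (y :* z) := y :* x :* z) refl

  x*yzw≈z*xyw : ∀ x y z w → x * (y * z * w) ≈ z * (x * y * w)
  x*yzw≈z*xyw = solve 4 (λ x y z w → x :* (y :* z :* w) := z :* (x :* y :* w)) refl

  -- n/d · m/e = k/f
  product-of-quotients : ∀ {x y z n m k d e f g} → d * e * f * g ≈ 1# →
    x * d ≈ n → y * e ≈ m → z * f ≈ k → n * m * f ≈ k * (d * e) → x * y ≈ z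
  product-of-quotients {x} {y} {z} {n} {m} {k} {d} {e} {f} unit xd ye zf nm = *-cancelʳ-unit unit (begin
    x * y * (d * e * f)
      ≈⟨ solve 5 (λ x y d e f → x :* y :* (d :* e :* f) := x :* d :* (y :* e) :* f) refl x y d e f ⟩
    x * d * (y * e) * f  ≈⟨ *-congʳ (*-cong xd ye) ⟩
    n * m * f            ≈⟨ nm ⟩
    k * (d * e)          ≈⟨ *-congʳ zf ⟨
    z * f * (d * e)
      ≈⟨ solve 4 (λ z d e f → z :* f :* (d :* e) := z :* (d :* e :* f)) refl z d e f ⟩
    z * (d * e * f)      ∎)

  complement-of-quotient : ∀ {x n d m} → x * d ≈ n → d - n ≈ m → (1# - x) * d ≈ m
  complement-of-quotient {x} {n} {d} {m} xd d-n = begin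
    -- The solver receives `1#` as a variable `o`, here and below; unit laws are applied by hand.
    (1# - x) * d    ≈⟨ solve 3 (λ o x d → (o :- x) :* d := o :* d :- x :* d) refl 1# x d ⟩
    1# * d - x * d  ≈⟨ +-cong (*-identityˡ d) (-‿cong xd) ⟩
    d - n           ≈⟨ d-n ⟩
    m               ∎

  -- The factorization w = (w²/z)·(z/w), checked after multiplying by the unit `w`.
  product-via-square : ∀ {v w w⁻ z q} → w * w⁻ ≈ 1# → v * w ≈ z → z * q ≈ w * w → v * q ≈ w
  product-via-square {v} {w} {w⁻} {z} {q} unit vw≈z zq≈ww = *-cancelʳ-unit unit (begin
    v * q * w  ≈⟨ solve 3 (λ v q w → v :* q :* w := v :* w :* q) refl v q w ⟩
    v * w * q  ≈⟨ *-congʳ vw≈z ⟩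
    z * q      ≈⟨ zq≈ww ⟩
    w * w      ∎)

  -- Reordering indices flips one determinant on each side of a cross-ratio equation, and the two
  -- signs cancel across it.
  cancel-signˡ : ∀ {x d d′ e n n′ m} → d ≈ - d′ → n ≈ - n′ → x * (d * e) ≈ n * m → x * (d′ * e) ≈ n′ * m
  cancel-signˡ {x} {d} {d′} {e} {n} {n′} {m} d≈ n≈ h = begin
    x * (d′ * e)      ≈⟨ solve 3 (λ x d e → x :* (d :* e) := :- (x :* (:- d :* e))) refl x d′ e ⟩
    - (x * (- d′ * e)) ≈⟨ -‿cong (*-congˡ (*-congʳ d≈)) ⟨
    - (x * (d * e))    ≈⟨ -‿cong h ⟩
    - (n * m)          ≈⟨ -‿cong (*-congʳ n≈) ⟩
    - (- n′ * m)       ≈⟨ solve 2 (λ n m → :- (:- n :* m) := n :* m) refl n′ m ⟩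
    n′ * m             ∎

  cleared-cong : ∀ {x d d′ e e′ n n′ m m′} → d ≈ d′ → e ≈ e′ → n ≈ n′ → m ≈ m′ →
    x * (d * e) ≈ n * m → x * (d′ * e′) ≈ n′ * m′
  cleared-cong d≈ e≈ n≈ m≈ h = trans (*-congˡ (sym (*-cong d≈ e≈))) (trans h (*-cong n≈ m≈))

  -- Here every determinant changes sign, so the signs cancel within each product.
  cancel-signs : ∀ {x d d′ e e′ n n′ m m′} → d ≈ - d′ → e ≈ - e′ → n ≈ - n′ → m ≈ - m′ →
    x * (d * e) ≈ n * m → x * (d′ * e′) ≈ n′ * m′
  cancel-signs {x} {d} {d′} {e} {e′} {n} {n′} {m} {m′} d≈ e≈ n≈ m≈ h = begin
    x * (d′ * e′)      ≈⟨ *-congˡ (-x*-y≈xy d′ e′) ⟨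
    x * (- d′ * - e′)  ≈⟨ *-congˡ (*-cong d≈ e≈) ⟨
    x * (d * e)        ≈⟨ h ⟩
    n * m              ≈⟨ *-cong n≈ m≈ ⟩
    - n′ * - m′        ≈⟨ -x*-y≈xy n′ m′ ⟩
    n′ * m′            ∎
    where
    -x*-y≈xy : ∀ x y → - x * - y ≈ x * y
    -x*-y≈xy = solve 2 (λ x y → (:- x) :* (:- y) := x :* y) refl

  Δ-swap : ∀ u v w → Δ u v w ≈ - Δ v u w
  Δ-swap u v w = solve 9 (λ u₀ u₁ u₂ v₀ v₁ v₂ w₀ w₁ w₂ →
      u₀ :* (v₁ :* w₂ :- v₂ :* w₁) :- u₁ :* (v₀ :* w₂ :- v₂ :* w₀) :+ u₂ :* (v₀ :* w₁ :- v₁ :* w₀)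
      := :- (v₀ :* (u₁ :* w₂ :- u₂ :* w₁) :- v₁ :* (u₀ :* w₂ :- u₂ :* w₀) :+ v₂ :* (u₀ :* w₁ :- u₁ :* w₀)))
    refl (u 0F) (u 1F) (u 2F) (v 0F) (v 1F) (v 2F) (w 0F) (w 1F) (w 2F)

  Δ-cycle : ∀ u v w → Δ u v w ≈ Δ v w u
  Δ-cycle u v w = solve 9 (λ u₀ u₁ u₂ v₀ v₁ v₂ w₀ w₁ w₂ →
      u₀ :* (v₁ :* w₂ :- v₂ :* w₁) :- u₁ :* (v₀ :* w₂ :- v₂ :* w₀) :+ u₂ :* (v₀ :* w₁ :- v₁ :* w₀)
      := v₀ :* (w₁ :* u₂ :- w₂ :* u₁) :- v₁ :* (w₀ :* u₂ :- w₂ :* u₀) :+ v₂ :* (w₀ :* u₁ :- w₁ :* u₀))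
    refl (u 0F) (u 1F) (u 2F) (v 0F) (v 1F) (v 2F) (w 0F) (w 1F) (w 2F)

  -- The parameters of the five-term relation whose last two arguments are
  -- cd and d are b = ca and a = (1 - cd)/(c(1 - d)).
  module _ {c d a b g} (unit : c * (1# - d) * (1# - d) * g ≈ 1#)
    (ea : a * (c * (1# - d)) ≈ 1# - c * d) (eb : b * (1# - d) ≈ 1# - c * d) where

    private
      -- The factors `c` and `c * d` are read as quotients with denominator `1#`.
      unit′ : 1# * (c * (1# - d)) * (1# - d) * g ≈ 1#
      unit′ = trans (*-congʳ (*-congʳ (*-identityˡ _))) unit

    parameters-ratio : c * a ≈ b
    parameters-ratio = product-of-quotients unit′ (*-identityʳ c) ea eb (trans
      (solve 3 (λ o c d → c :* (o :- c :* d) :* (o :- d) := (o :- c :* d) :* (c :* (o :- d))) refl 1# c d)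
      (*-congˡ (sym (*-identityˡ _))))

    -- Here 1 - a = (c - 1)/(c(1 - d)) and 1 - b = d(c - 1)/(1 - d), whose ratio is visibly cd.
    parameters-complement-ratio : c * d * (1# - a) ≈ 1# - b
    parameters-complement-ratio = product-of-quotients unit′ (*-identityʳ (c * d))
      (complement-of-quotient ea refl) (complement-of-quotient eb refl) (begin
        c * d * (c * (1# - d) - (1# - c * d)) * (1# - d)
          ≈⟨ *-congʳ (*-congˡ (+-congʳ (distrib-1 c d))) ⟩
        c * d * (c - c * d - (1# - c * d)) * (1# - d)
          ≈⟨ solve 3 (λ o c d → c :* d :* (c :- c :* d :- (o :- c :* d)) :* (o :- d)
               := (c :* d :- d :* o) :* (c :* (o :- d))) refl 1# c d ⟩
        (c * d - d * 1#) * (c * (1# - d))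
          ≈⟨ *-congʳ (+-congˡ (-‿cong (*-identityʳ d))) ⟩
        (c * d - d) * (c * (1# - d))
          ≈⟨ *-cong (solve 3 (λ o c d → c :* d :- d := (o :- d) :- (o :- c :* d)) refl 1# c d)
                    (sym (*-identityˡ _)) ⟩
        (1# - d - (1# - c * d)) * (1# * (c * (1# - d))) ∎)
      where
      distrib-1 : ∀ x y → x * (1# - y) ≈ x - x * y
      distrib-1 x y = trans (solve 3 (λ o x y → x :* (o :- y) := x :* o :- x :* y) refl 1# x y)
        (+-congʳ (*-identityʳ x))

  Unit : Carrier → Set _
  Unit z = ∃ λ w → z * w ≈ 1#

  Unit-* : ∀ {y z} → Unit y → Unit z → Unit (y * z)
  Unit-* {y} {z} (y⁻ , yy⁻≈1) (z⁻ , zz⁻≈1) = y⁻ * z⁻ , (begin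
    y * z * (y⁻ * z⁻)
      ≈⟨ solve 4 (λ y z y⁻ z⁻ → y :* z :* (y⁻ :* z⁻) := y :* y⁻ :* (z :* z⁻)) refl y z y⁻ z⁻ ⟩
    y * y⁻ * (z * z⁻)  ≈⟨ *-cong yy⁻≈1 zz⁻≈1 ⟩
    1# * 1#            ≈⟨ *-identityˡ 1# ⟩
    1#                 ∎)

  -- Multiplicative relations between the cross-ratios of five vectors.

  module FivePoints (v : Fin 5 → Vector Carrier 3) where

    D : Fin 5 → Fin 5 → Fin 5 → Carrier
    D i j k = Δ (v i) (v j) (v k)

    -- Clearing denominators leaves only ring identities to check. The value is still determined
    -- when the determinants are units.
    IsCrossRatio : Carrier → (i j k l m : Fin 5) → Set _
    IsCrossRatio r i j k l m = r * (D i j l * D i k m) ≈ D i j m * D i k l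

    private
      swap : ∀ i j k → D i j k ≈ - D j i k
      swap i j k = Δ-swap (v i) (v j) (v k)

      cycle : ∀ i j k → D i j k ≈ D j k i
      cycle i j k = Δ-cycle (v i) (v j) (v k)

    -- Denominator minus numerator is the left-hand side of the Plücker relation for projection from
    -- the i-th vector.
    complement-cleared : ∀ {r} i j k l m → IsCrossRatio r i j k l m →
      (1# - r) * (D i j l * D i k m) ≈ D i j k * D i l m
    complement-cleared i j k l m h =
      complement-of-quotient h (Determinant.plücker R (v i) (v j) (v k) (v l) (v m))

    module _
      (unit : ∀ {i j k} → i ≢ j → i ≢ k → j ≢ k → Unit (D i j k))
      {r₀ r₁ r₂ r₃ r₄ : Carrier}
      (h₀ : IsCrossRatio r₀ 0F 1F 2F 3F 4F)
      (h₁ : IsCrossRatio r₁ 1F 0F 2F 3F 4F)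
      (h₂ : IsCrossRatio r₂ 2F 0F 1F 3F 4F)
      (h₃ : IsCrossRatio r₃ 3F 0F 1F 2F 4F)
      (h₄ : IsCrossRatio r₄ 4F 0F 1F 2F 3F)
      where

      private
        -- The equations in this block have all their determinants in increasing index order, so
        -- that common factors match literally.
        r₁-cleared : r₁ * (D 0F 1F 3F * D 1F 2F 4F) ≈ D 0F 1F 4F * D 1F 2F 3F
        r₁-cleared = cancel-signˡ (swap 1F 0F 3F) (swap 1F 0F 4F) h₁

        1-r₁-cleared : (1# - r₁) * (D 0F 1F 3F * D 1F 2F 4F) ≈ D 0F 1F 2F * D 1F 3F 4F
        1-r₁-cleared = cancel-signˡ (swap 1F 0F 3F) (swap 1F 0F 2F)
          (complement-cleared 1F 0F 2F 3F 4F h₁)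

        r₂-cleared : r₂ * (D 0F 2F 3F * D 1F 2F 4F) ≈ D 0F 2F 4F * D 1F 2F 3F
        r₂-cleared = cancel-signs (swap 2F 0F 3F) (swap 2F 1F 4F) (swap 2F 0F 4F) (swap 2F 1F 3F) h₂

        r₃-cleared : r₃ * (D 1F 3F 4F * D 0F 2F 3F) ≈ D 0F 3F 4F * D 1F 2F 3F
        r₃-cleared = cancel-signˡ (swap 3F 1F 4F) (swap 3F 0F 4F)
          (trans (*-congˡ (*-comm _ _))
            (cleared-cong (cycle 3F 0F 2F) refl refl (cycle 3F 1F 2F) h₃))

        r₄-cleared : r₄ * (D 0F 2F 4F * D 1F 3F 4F) ≈ D 0F 3F 4F * D 1F 2F 4F
        r₄-cleared = cleared-cong
          (cycle 4F 0F 2F) (cycle 4F 1F 3F) (cycle 4F 0F 3F) (cycle 4F 1F 2F) h₄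

        unit-013 : Unit (D 0F 1F 3F)
        unit-013 = unit (λ ()) (λ ()) (λ ())

        unit-023 : Unit (D 0F 2F 3F)
        unit-023 = unit (λ ()) (λ ()) (λ ())

        unit-024 : Unit (D 0F 2F 4F)
        unit-024 = unit (λ ()) (λ ()) (λ ())

        unit-124 : Unit (D 1F 2F 4F)
        unit-124 = unit (λ ()) (λ ()) (λ ())

        unit-134 : Unit (D 1F 3F 4F)
        unit-134 = unit (λ ()) (λ ()) (λ ())

      -- The determinants 023 and 024 cancel between the two factors.
      r₂r₀≈r₁ : r₂ * r₀ ≈ r₁
      r₂r₀≈r₁ = product-of-quotients
        (proj₂ (Unit-* (Unit-* (Unit-* unit-023 unit-124) (Unit-* unit-013 unit-024)) (Unit-* unit-013 unit-124)))
        r₂-cleared h₀ r₁-cleared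
        (solve 6 (λ A B C E P Q →
          E :* P :* (B :* C) :* (A :* Q) := B :* P :* (C :* Q :* (A :* E))) refl
          (D 0F 1F 3F) (D 0F 1F 4F) (D 0F 2F 3F) (D 0F 2F 4F) (D 1F 2F 3F) (D 1F 2F 4F))

      -- The determinants 024 and 124 cancel between the two factors.
      r₄r₂≈r₃ : r₄ * r₂ ≈ r₃
      r₄r₂≈r₃ = product-of-quotients
        (proj₂ (Unit-* (Unit-* (Unit-* unit-024 unit-134) (Unit-* unit-023 unit-124)) (Unit-* unit-134 unit-023)))
        r₄-cleared r₂-cleared r₃-cleared
        (solve 6 (λ C E G P Q S →
          G :* Q :* (E :* P) :* (S :* C) := G :* P :* (E :* S :* (C :* Q))) refl
          (D 0F 2F 3F) (D 0F 2F 4F) (D 0F 3F 4F) (D 1F 2F 3F) (D 1F 2F 4F) (D 1F 3F 4F))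

      -- The determinants 124 and 134 cancel, leaving 012·034 over 013·024, which is the Plücker
      -- form of 1 - r₀.
      r₄[1-r₁]≈1-r₀ : r₄ * (1# - r₁) ≈ 1# - r₀
      r₄[1-r₁]≈1-r₀ = product-of-quotients
        (proj₂ (Unit-* (Unit-* (Unit-* unit-024 unit-134) (Unit-* unit-013 unit-124)) (Unit-* unit-013 unit-024)))
        r₄-cleared 1-r₁-cleared (complement-cleared 0F 1F 2F 3F 4F h₀)
        (solve 6 (λ A E G O Q S →
          G :* Q :* (O :* S) :* (A :* E) := O :* G :* (E :* S :* (A :* Q))) refl
          (D 0F 1F 3F) (D 0F 2F 4F) (D 0F 3F 4F) (D 0F 1F 2F) (D 1F 2F 4F) (D 1F 3F 4F))

-- Avoiding one of two disjoint pairs.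

module Separation {c ℓ₁ ℓ₂} (A : ApartnessRelation c ℓ₁ ℓ₂) where
  open ApartnessRelation A

  -- Cotransitivity makes `z` apart from one member of each of the four cross pairs. If `p` or `p′`
  -- is never the one chosen, its two comparisons choose both `q` and `q′`.
  pair-or-pair-apart : ∀ {p p′ q q′} → p # q → p # q′ → p′ # q → p′ # q′ →
    ∀ z → p # z ∧ p′ # z ⊎ q # z ∧ q′ # z
  pair-or-pair-apart pq pq′ p′q p′q′ z with cotrans pq z | cotrans pq′ z | cotrans p′q z | cotrans p′q′ z
  ... | inj₁ pz | _        | inj₁ p′z | _        = inj₁ (pz , p′z)
  ... | inj₁ pz | _        | inj₂ _   | inj₁ p′z = inj₁ (pz , p′z)
  ... | inj₁ _  | _        | inj₂ zq  | inj₂ zq′ = inj₂ (sym zq , sym zq′)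
  ... | inj₂ _  | inj₁ pz  | inj₁ p′z | _        = inj₁ (pz , p′z)
  ... | inj₂ zq | inj₂ zq′ | _        | _        = inj₂ (sym zq , sym zq′)
  ... | inj₂ _  | inj₁ pz  | inj₂ _   | inj₁ p′z = inj₁ (pz , p′z)
  ... | inj₂ zq | inj₁ _   | inj₂ _   | inj₂ zq′ = inj₂ (sym zq , sym zq′)

-- Brackets indexed by dual numbers and the five-term relation.

module TangentBlochGroup {c ℓ₁ ℓ₂} (F : HeytingField c ℓ₁ ℓ₂) where
  open HeytingField F
  open HeytingCommutativeRing heytingCommutativeRing using (commutativeRing)
  open CommutativeRing commutativeRing using (semiring)
  open SemiringMult semiring using (×-homo-+; ×1-homo-*; ×-homo-1) renaming (_×_ to _·ℕ_)
  open HCRProperties heytingCommutativeRing using (x#0y#0→xy#0; #-congʳ; #-congˡ; 1#0)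
  open IntegerRingSolver commutativeRing using (solve; _:=_; _:+_; _:*_; _:-_; :-_)
  open CommutativeRingLemmas commutativeRing using (*-cancelʳ-unit)
  open OverField F
  open ≈-Reasoning setoid

  private
    module T = AbelianGroup T𝓑₂
    module T-Lemmas = AbelianGroupLemmas T𝓑₂
    module ε-Lemmas = CommutativeRingLemmas dualNumbers
    module ≈ε-Reasoning = ≈-Reasoning F[ε].setoid

  -- Bundling the evidence with a single element of F[ε]₂ turns the derivative formulas of the
  -- relations into ordinary algebra of dual numbers.
  record Argument : Set (c ⊔ ℓ₂) where
    field
      value   : F[ε].Carrier
      value#0 : proj₁ value # 0#
      value#1 : proj₁ value # 1#

    1-value#0 : 1# - proj₁ value # 0#
    1-value#0 = x#1⇒1-x#0 value#1

  open Argument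

  ⟪_⟫ : Argument → T.Carrier
  ⟪ z ⟫ = ⟨ proj₁ (value z) ⨟ proj₂ (value z) ∣ value#0 z ∣ value#1 z ]₂

  ⟪⟫-cong : ∀ y z → value y F[ε].≈ value z → ⟪ y ⟫ T.≈ ⟪ z ⟫
  ⟪⟫-cong y z (e , e′) = AbelianGroupLemmas.≈⇒∼ generated
    (ℤ[F[ε]].+-cong (ℤ[F[ε]].[]-cong (e , e′)) (ℤ[F[ε]].-‿cong (ℤ[F[ε]].[]-cong (e , refl))))

  -- The generator is then `[ a , 0# ]` minus itself, so it vanishes already in the free group.
  ⟪⟫-real : ∀ z → proj₂ (value z) ≈ 0# → ⟪ z ⟫ T.≈ T.ε
  ⟪⟫-real z e = AbelianGroupLemmas.≈⇒∼ generated
    (ℤ[F[ε]].trans (ℤ[F[ε]].+-cong (ℤ[F[ε]].[]-cong (refl , e)) ℤ[F[ε]].refl)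
      (ℤ[F[ε]].trans (ℤ[F[ε]].+-comm _ _) (ℤ[F[ε]].-‿inverseˡ _)))

  unit-inverse : ∀ z → proj₁ z # 0# → F[ε].Carrier
  unit-inverse z z#0 = proj₁ (ε-invertible z z#0)

  unit-inverseʳ : ∀ z (z#0 : proj₁ z # 0#) → z F[ε].* unit-inverse z z#0 F[ε].≈ F[ε].1#
  unit-inverseʳ z z#0 = proj₂ (proj₂ (ε-invertible z z#0))

  quotient : ∀ x y → proj₁ x # 0# → proj₁ y # 0# → proj₁ x # proj₁ y → Argument
  quotient x y x#0 y#0 x#y = record
    { value = x F[ε].* unit-inverse y y#0 ; value#0 = x/y#0 x#0 y#0 ; value#1 = x/y#1 x#y y#0 }

  x/y*y≈x : ∀ x y (y#0 : proj₁ y # 0#) → x F[ε].* unit-inverse y y#0 F[ε].* y F[ε].≈ x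
  x/y*y≈x x y y#0 = F[ε].trans (F[ε].*-assoc _ _ _)
    (F[ε].trans (F[ε].*-congˡ (proj₁ (proj₂ (ε-invertible y y#0)))) (F[ε].*-identityʳ x))

  infix 9 _⁻
  _⁻ : Argument → Argument
  z ⁻ = quotient F[ε].1# (value z) 1#0 (value#0 z) (#-sym (value#1 z))

  ⁻-inverseˡ : ∀ z → value (z ⁻) F[ε].* value z F[ε].≈ F[ε].1#
  ⁻-inverseˡ z = x/y*y≈x F[ε].1# (value z) (value#0 z)

  ⁻-inverseʳ : ∀ z → value z F[ε].* value (z ⁻) F[ε].≈ F[ε].1#
  ⁻-inverseʳ z = F[ε].trans (F[ε].*-comm _ _) (⁻-inverseˡ z)

  ⁻-transpose : ∀ z {x y} → value z F[ε].* x F[ε].≈ y → value (z ⁻) F[ε].* y F[ε].≈ x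
  ⁻-transpose z {x} e =
    F[ε].trans (F[ε].*-congˡ (F[ε].sym e)) (ε-Lemmas.x⁻¹xy≈y x (⁻-inverseˡ z))

  ⁻-involutive : ∀ z → value (z ⁻ ⁻) F[ε].≈ value z
  ⁻-involutive z = F[ε].trans (F[ε].sym (F[ε].*-identityʳ _)) (⁻-transpose (z ⁻) (⁻-inverseˡ z))

  ⁻-product : ∀ e c d → value e F[ε].* value c F[ε].≈ value d →
    value (e ⁻) F[ε].* value (c ⁻) F[ε].≈ value (d ⁻)
  ⁻-product e c d h = ⁻-transpose e (F[ε].trans (F[ε].sym (⁻-transpose c c*[e*d⁻]≈1)) (F[ε].*-identityʳ _))
    where
    c*[e*d⁻]≈1 : value c F[ε].* (value e F[ε].* value (d ⁻)) F[ε].≈ F[ε].1#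
    c*[e*d⁻]≈1 = F[ε].trans
      (ε-Lemmas.x*yz≈yx*z (value c) (value e) (value (d ⁻)))
      (F[ε].trans (F[ε].*-congʳ h) (⁻-inverseʳ d))

  -- x - y = (1 - c)x is a product of two elements apart from zero.
  ratio#1⇒apart : ∀ {c x y} → x # 0# → c # 1# → c * x ≈ y → x # y
  ratio#1⇒apart {c} {x} {y} x#0 c#1 cx≈y = x-y#0⇒x#y
    (#-congʳ (begin
      (1# - c) * x    ≈⟨ solve 3 (λ o c x → (o :- c) :* x := o :* x :- c :* x) refl 1# c x ⟩
      1# * x - c * x  ≈⟨ +-cong (*-identityˡ x) (-‿cong cx≈y) ⟩
      x - y           ∎)
      (x#0y#0→xy#0 (x#1⇒1-x#0 c#1) x#0))

  *-cancelʳ-#0 : ∀ {x y z} → z # 0# → x * z ≈ y * z → x ≈ y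
  *-cancelʳ-#0 z#0 = *-cancelʳ-unit (⁻¹-inverseʳ z#0)

  /-cancelʳ : ∀ x {y} (y#0 : y # 0#) → (x / y ⟨ y#0 ⟩) * y ≈ x
  /-cancelʳ x {y} y#0 = trans (*-assoc _ _ _) (trans (*-congˡ (⁻¹-inverseˡ y#0)) (*-identityʳ x))

  -- The ε-coefficient of zy = x is the Leibniz rule. Eliminating z₀ from it gives z′y₀² = y₀x′ -
  -- y′x₀, so the primed fractions of the five-term relation are the ε-parts of quotients of dual
  -- numbers.
  quotient-rule : ∀ {x y z n} (y#0 : proj₁ y # 0#) (yy#0 : proj₁ y * proj₁ y # 0#) →
    z F[ε].* y F[ε].≈ x → n ≈ proj₁ y * proj₂ x - proj₂ y * proj₁ x →
    z F[ε].≈ (proj₁ x / proj₁ y ⟨ y#0 ⟩ , n / (proj₁ y * proj₁ y) ⟨ yy#0 ⟩)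
  quotient-rule {x , x′} {y , y′} {z , z′} {n} y#0 yy#0 (e , e′) n≈ =
      *-cancelʳ-#0 y#0 (trans e (sym (/-cancelʳ x y#0)))
    , *-cancelʳ-#0 yy#0 (begin
      z′ * (y * y)
        ≈⟨ solve 4 (λ z z′ y y′ → z′ :* (y :* y) := y :* (z :* y′ :+ z′ :* y) :- y′ :* (z :* y)) refl z z′ y y′ ⟩
      y * (z * y′ + z′ * y) - y′ * (z * y)  ≈⟨ +-cong (*-congˡ e′) (-‿cong (*-congˡ e)) ⟩
      y * x′ - y′ * x                       ≈⟨ n≈ ⟨
      n                                     ≈⟨ /-cancelʳ n yy#0 ⟨
      n / (y * y) ⟨ yy#0 ⟩ * (y * y)        ∎)

  -- The fifth argument a(1 - b)/(b(1 - a)) is d/c. The division-free form fits products of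
  -- cross-ratios and is easily inverted.
  record FiveTermParameters (a b c d e : Argument) : Set ℓ₁ where
    field
      ratio            : value c F[ε].* value a F[ε].≈ value b
      complement-ratio : value d F[ε].* (F[ε].1# F[ε].- value a) F[ε].≈ F[ε].1# F[ε].- value b
      ratio-of-ratios  : value e F[ε].* value c F[ε].≈ value d

  open FiveTermParameters

  fiveTerm⇒≈ε : ∀ {x} y → FiveTerm x → proj₁ x ℤ[F[ε]].≈ proj₁ y → y T.≈ T.ε
  fiveTerm⇒≈ε y h e = AbelianGroupLemmas.relation⇒∼ε generated y h e

  five-term : ∀ a b c d e → FiveTermParameters a b c d e →
    ⟪ a ⟫ T.∙ ⟪ c ⟫ T.∙ ⟪ e ⟫ T.≈ ⟪ b ⟫ T.∙ ⟪ d ⟫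
  five-term a b c d e h = T-Lemmas.alternating⇒balanced ⟪ a ⟫ ⟪ b ⟫ ⟪ c̃ ⟫ ⟪ d̃ ⟫ ⟪ ẽ ⟫ ⟪ c ⟫ ⟪ d ⟫ ⟪ e ⟫
    relation (⟪⟫-cong c c̃ c≈) (⟪⟫-cong d d̃ d≈) (⟪⟫-cong e ẽ e≈)
    where
    a₀ = proj₁ (value a)
    a′ = proj₂ (value a)
    b₀ = proj₁ (value b)
    b′ = proj₂ (value b)

    a#b : a₀ # b₀
    a#b = ratio#1⇒apart (value#0 a) (value#1 c) (proj₁ (ratio h))

    open FiveTermArguments a₀ b₀ (value#0 a) (value#1 a) (value#0 b) (value#1 b) a#b

    -- The literal fractions of `FiveTerm`; the given `c`, `d`, `e` agree with them because
    -- quotients by units are unique.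
    c̃ d̃ ẽ : Argument
    c̃ = record
      { value = b₀ / a₀ ⟨ value#0 a ⟩ , (a₀ * b′ - a′ * b₀) / (a₀ * a₀) ⟨ a²#0 ⟩
      ; value#0 = x/y#0 (value#0 b) (value#0 a)
      ; value#1 = x/y#1 (#-sym a#b) (value#0 a)
      }
    d̃ = record
      { value = (1# - b₀) / (1# - a₀) ⟨ 1-a#0 ⟩
              , ((1# - b₀) * a′ - (1# - a₀) * b′) / ((1# - a₀) * (1# - a₀)) ⟨ [1-a]²#0 ⟩
      ; value#0 = x/y#0 1-b#0 1-a#0
      ; value#1 = x/y#1 1-b#1-a 1-a#0
      }
    ẽ = record
      { value = (a₀ * (1# - b₀)) / (b₀ * (1# - a₀)) ⟨ b[1-a]#0 ⟩
              , (b₀ * (1# - b₀) * a′ - a₀ * (1# - a₀) * b′)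
                  / ((b₀ * (1# - a₀)) * (b₀ * (1# - a₀))) ⟨ [b[1-a]]²#0 ⟩
      ; value#0 = x/y#0 a[1-b]#0 b[1-a]#0
      ; value#1 = x/y#1 a[1-b]#b[1-a] b[1-a]#0
      }

    relation : ((⟪ a ⟫ T.- ⟪ b ⟫) T.∙ ⟪ c̃ ⟫ T.- ⟪ d̃ ⟫) T.∙ ⟪ ẽ ⟫ T.≈ T.ε
    relation = fiveTerm⇒≈ε (((⟪ a ⟫ T.- ⟪ b ⟫) T.∙ ⟪ c̃ ⟫ T.- ⟪ d̃ ⟫) T.∙ ⟪ ẽ ⟫)
      (fiveTerm a₀ a′ b₀ b′ (value#0 a) (value#1 a) (value#0 b) (value#1 b) a#b) ℤ[F[ε]].refl

    -- The unit of F[ε]₂ is (1 , 0), so the ε-part of 1 - a appears as `0# - a′`.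
    0-x : ∀ x → 0# - x ≈ - x
    0-x x = +-identityˡ (- x)

    c≈ : value c F[ε].≈ value c̃
    c≈ = quotient-rule (value#0 a) a²#0 (ratio h) refl

    d≈ : value d F[ε].≈ value d̃
    d≈ = quotient-rule 1-a#0 [1-a]²#0 (complement-ratio h) (begin
      (1# - b₀) * a′ - (1# - a₀) * b′
        ≈⟨ solve 4 (λ p q a′ b′ → q :* a′ :- p :* b′ := p :* (:- b′) :- (:- a′) :* q)
             refl (1# - a₀) (1# - b₀) a′ b′ ⟩
      (1# - a₀) * - b′ - - a′ * (1# - b₀)
        ≈⟨ +-cong (*-congˡ (0-x b′)) (-‿cong (*-congʳ (0-x a′))) ⟨
      (1# - a₀) * (0# - b′) - (0# - a′) * (1# - b₀) ∎)

    e*b[1-a]≈a[1-b] : value e F[ε].* (value b F[ε].* (F[ε].1# F[ε].- value a))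
      F[ε].≈ value a F[ε].* (F[ε].1# F[ε].- value b)
    e*b[1-a]≈a[1-b] = E.begin
      value e F[ε].* (value b F[ε].* 1-a)
        E.≈⟨ F[ε].*-congˡ (F[ε].*-congʳ (ratio h)) ⟨
      value e F[ε].* (value c F[ε].* value a F[ε].* 1-a)
        E.≈⟨ ε-Lemmas.x*yzw≈z*xyw (value e) (value c) (value a) 1-a ⟩
      value a F[ε].* (value e F[ε].* value c F[ε].* 1-a)
        E.≈⟨ F[ε].*-congˡ (F[ε].trans (F[ε].*-congʳ (ratio-of-ratios h)) (complement-ratio h)) ⟩
      value a F[ε].* (F[ε].1# F[ε].- value b) E.∎
      where
      module E = ≈ε-Reasoning
      1-a = F[ε].1# F[ε].- value a

    e≈ : value e F[ε].≈ value ẽ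
    e≈ = quotient-rule b[1-a]#0 [b[1-a]]²#0 e*b[1-a]≈a[1-b] (begin
      b₀ * (1# - b₀) * a′ - a₀ * (1# - a₀) * b′
        ≈⟨ solve 5 (λ o a b a′ b′ →
             b :* (o :- b) :* a′ :- a :* (o :- a) :* b′
               := b :* ((o :- b) :* a′) :- a :* ((o :- a) :* b′)) refl 1# a₀ b₀ a′ b′ ⟩
      b₀ * ((1# - b₀) * a′) - a₀ * ((1# - a₀) * b′)
        -- With `1#` as a variable `o` the identity must be homogeneous: the inserted factor matches
        -- (o - a) + a = o in the `a′` terms and (o - b) + b = o in the `b′` terms.
        ≈⟨ +-cong (*-congˡ (*-identityˡ _)) (-‿cong (*-congˡ (*-identityˡ _))) ⟨
      b₀ * (1# * ((1# - b₀) * a′)) - a₀ * (1# * ((1# - a₀) * b′))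
        ≈⟨ solve 5 (λ o a b a′ b′ →
             b :* (o :* ((o :- b) :* a′)) :- a :* (o :* ((o :- a) :* b′))
               := b :* (o :- a) :* (a :* (:- b′) :+ a′ :* (o :- b))
                  :- (b :* (:- a′) :+ b′ :* (o :- a)) :* (a :* (o :- b)))
             refl 1# a₀ b₀ a′ b′ ⟩
      b₀ * (1# - a₀) * (a₀ * - b′ + a′ * (1# - b₀))
        - (b₀ * - a′ + b′ * (1# - a₀)) * (a₀ * (1# - b₀))
        ≈⟨ +-cong (*-congˡ (+-congʳ (*-congˡ (0-x b′))))
                  (-‿cong (*-congʳ (+-congʳ (*-congˡ (0-x a′))))) ⟨
      b₀ * (1# - a₀) * (a₀ * (0# - b′) + a′ * (1# - b₀))
        - (b₀ * (0# - a′) + b′ * (1# - a₀)) * (a₀ * (1# - b₀)) ∎)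

  -- The remaining argument uses only these properties of the bracket, so it is carried out for any
  -- function into an abelian group that has them.
  record FiveTermFunction {a ℓ} (A : AbelianGroup a ℓ) : Set (c ⊔ ℓ₁ ⊔ ℓ₂ ⊔ a ⊔ ℓ) where
    open AbelianGroup A using () renaming (Carrier to |A|; _≈_ to _≈ᴬ_; _∙_ to _∙ᴬ_; ε to εᴬ)
    field
      apply       : Argument → |A|
      apply-cong  : ∀ y z → value y F[ε].≈ value z → apply y ≈ᴬ apply z
      apply-real  : ∀ z → proj₂ (value z) ≈ 0# → apply z ≈ᴬ εᴬ
      apply-five  : ∀ a b c d e → FiveTermParameters a b c d e →
        (apply a ∙ᴬ apply c) ∙ᴬ apply e ≈ᴬ apply b ∙ᴬ apply d

  bracket : FiveTermFunction T𝓑₂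
  bracket = record
    { apply = ⟪_⟫ ; apply-cong = ⟪⟫-cong ; apply-real = ⟪⟫-real ; apply-five = five-term }

  -- Exchanging a and b inverts b/a and (1 - b)/(1 - a), hence also their ratio.
  FiveTermParameters-swap : ∀ {a b c d e} → FiveTermParameters a b c d e →
    FiveTermParameters b a (c ⁻) (d ⁻) (e ⁻)
  FiveTermParameters-swap {c = c} {d} {e} h = record
    { ratio            = ⁻-transpose c (ratio h)
    ; complement-ratio = ⁻-transpose d (complement-ratio h)
    ; ratio-of-ratios  = ⁻-product e c d (ratio-of-ratios h)
    }

  -- Eliminating b from b = ca and 1 - b = ce(1 - a) gives a = (1 - ce)/(c(1 - e)). Both parameters
  -- are nonzero since ce = d ≠ 1, and differ from 1 since c ≠ 1 and e ≠ 0.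
  module ParametersFromRatios (c d e : Argument) (ec≈d : value e F[ε].* value c F[ε].≈ value d) where
    private
      c₀ = proj₁ (value c)
      e₀ = proj₁ (value e)
      1-e = F[ε].1# F[ε].- value e
      1-ce = F[ε].1# F[ε].- value c F[ε].* value e
      c[1-e] = value c F[ε].* 1-e

      ce≈d : value c F[ε].* value e F[ε].≈ value d
      ce≈d = F[ε].trans (F[ε].*-comm _ _) ec≈d

      1-ce#0 : proj₁ 1-ce # 0#
      1-ce#0 = x#1⇒1-x#0 (#-congʳ (sym (proj₁ ce≈d)) (value#1 d))

      c[1-e]#0 : proj₁ c[1-e] # 0#
      c[1-e]#0 = x#0y#0→xy#0 (value#0 c) (1-value#0 e)

      1-ce#c[1-e] : proj₁ 1-ce # proj₁ c[1-e]
      1-ce#c[1-e] = x-y#0⇒x#y (#-congʳ (begin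
        1# - c₀                           ≈⟨ +-congˡ (-‿cong (*-identityʳ c₀)) ⟨
        1# - c₀ * 1#
          ≈⟨ solve 3 (λ o c e → o :- c :* o := (o :- c :* e) :- c :* (o :- e)) refl 1# c₀ e₀ ⟩
        1# - c₀ * e₀ - c₀ * (1# - e₀)     ∎) (1-value#0 c))

      1-ce#1-e : proj₁ 1-ce # proj₁ 1-e
      1-ce#1-e = x-y#0⇒x#y (#-congʳ (begin
        e₀ * (1# - c₀)
          ≈⟨ solve 3 (λ o c e → e :* (o :- c) := e :* o :- c :* e) refl 1# c₀ e₀ ⟩
        e₀ * 1# - c₀ * e₀                 ≈⟨ +-congʳ (*-identityʳ e₀) ⟩
        e₀ - c₀ * e₀
          ≈⟨ solve 3 (λ o c e → e :- c :* e := (o :- c :* e) :- (o :- e)) refl 1# c₀ e₀ ⟩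
        1# - c₀ * e₀ - (1# - e₀)          ∎) (x#0y#0→xy#0 (value#0 e) (1-value#0 c)))

      c[1-e]²#0 : proj₁ (c[1-e] F[ε].* 1-e) # 0#
      c[1-e]²#0 = x#0y#0→xy#0 c[1-e]#0 (1-value#0 e)

      unit : c[1-e] F[ε].* 1-e F[ε].* unit-inverse (c[1-e] F[ε].* 1-e) c[1-e]²#0 F[ε].≈ F[ε].1#
      unit = unit-inverseʳ (c[1-e] F[ε].* 1-e) c[1-e]²#0

    a b : Argument
    a = quotient 1-ce c[1-e] 1-ce#0 c[1-e]#0 1-ce#c[1-e]
    b = quotient 1-ce 1-e 1-ce#0 (1-value#0 e) 1-ce#1-e

    private
      ea : value a F[ε].* c[1-e] F[ε].≈ 1-ce
      ea = x/y*y≈x 1-ce c[1-e] c[1-e]#0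

      eb : value b F[ε].* 1-e F[ε].≈ 1-ce
      eb = x/y*y≈x 1-ce 1-e (1-value#0 e)

    parameters : FiveTermParameters a b c d e
    parameters = record
      { ratio            = ε-Lemmas.parameters-ratio unit ea eb
      ; complement-ratio = F[ε].trans (F[ε].*-congʳ (F[ε].sym ce≈d))
          (ε-Lemmas.parameters-complement-ratio unit ea eb)
      ; ratio-of-ratios  = ec≈d
      }

  -- The inversion relation.

  module Inversion {g ℓ} {A : AbelianGroup g ℓ} (φ : FiveTermFunction A) where
    open FiveTermFunction φ
    open AbelianGroupLemmas A using (x∙y≈y⇒x≈ε; add-balanced)
    private
      module A = AbelianGroup A
      module E = ≈-Reasoning A.setoid

    -- The obstruction to the inversion relation.
    defect : Argument → A.Carrier
    defect z = apply z A.∙ apply (z ⁻)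

    defect-⁻ : ∀ z → defect (z ⁻) A.≈ defect z
    defect-⁻ z = A.trans (A.∙-congˡ (apply-cong (z ⁻ ⁻) z (⁻-involutive z))) (A.comm _ _)

    defect-product : ∀ c d e → value e F[ε].* value c F[ε].≈ value d →
      defect c A.∙ defect e A.≈ defect d
    defect-product c d e ec≈d = add-balanced
      (apply-five a b c d e parameters)
      (apply-five b a (c ⁻) (d ⁻) (e ⁻) (FiveTermParameters-swap parameters))
      where open ParametersFromRatios c d e ec≈d

    -- 3f(z) = f(z²) + f(1/z) = f(z). The product z·(1/z) = 1 is not an argument, hence the detour
    -- through the square, which must itself differ from 1.
    defect-double : ∀ z p → value z F[ε].* value z F[ε].≈ value p →
      defect z A.∙ defect z A.≈ A.ε
    defect-double z p zz≈p = x∙y≈y⇒x≈ε (E.begin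
      defect z A.∙ defect z A.∙ defect z  E.≈⟨ A.∙-cong (defect-product z p z zz≈p) (A.sym (defect-⁻ z)) ⟩
      defect p A.∙ defect (z ⁻)           E.≈⟨ defect-product p z (z ⁻) (⁻-transpose z zz≈p) ⟩
      defect z                            E.∎)

    defect-real : ∀ z → proj₂ (value z) ≈ 0# → defect z A.≈ A.ε
    defect-real z z′≈0 = A.trans
      (A.∙-cong (apply-real z z′≈0) (apply-real (z ⁻) z⁻′≈0)) (A.identityˡ A.ε)
      where
      u = value#0 z

      z⁻′≈0 : proj₂ (value (z ⁻)) ≈ 0#
      -- In the ε-coefficient of (1/z)·z = 1 the term containing z′ drops out.
      z⁻′≈0 = *-cancelʳ-#0 u (begin
        proj₂ (value (z ⁻)) * proj₁ (value z)
          ≈⟨ trans (+-congʳ (trans (*-congˡ z′≈0) (zeroʳ _))) (+-identityˡ _) ⟨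
        proj₁ (value (z ⁻)) * proj₂ (value z) + proj₂ (value (z ⁻)) * proj₁ (value z)
          ≈⟨ proj₂ (⁻-inverseˡ z) ⟩
        0#                       ≈⟨ zeroˡ _ ⟨
        0# * proj₁ (value z)     ∎)

    -- The factor v contributes f(w), because w = vq and f(q) = 0; hence f(z) = f(w) + f(v) = 2f(w).
    defect-split : ∀ w v z q p →
      value v F[ε].* value w F[ε].≈ value z → value v F[ε].* value q F[ε].≈ value w →
      proj₂ (value q) ≈ 0# → value w F[ε].* value w F[ε].≈ value p →
      defect z A.≈ A.ε
    defect-split w v z q p vw≈z vq≈w q′≈0 ww≈p = E.begin
      defect z               E.≈⟨ defect-product w z v vw≈z ⟨
      defect w A.∙ defect v  E.≈⟨ A.∙-congˡ (A.identityˡ _) ⟨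
      defect w A.∙ (A.ε A.∙ defect v)       E.≈⟨ A.∙-congˡ (A.∙-congʳ (defect-real q q′≈0)) ⟨
      defect w A.∙ (defect q A.∙ defect v)  E.≈⟨ A.∙-congˡ (defect-product q w v vq≈w) ⟩
      defect w A.∙ defect w  E.≈⟨ defect-double w p ww≈p ⟩
      A.ε                    E.∎

    -- The apartness conditions make all auxiliary elements arguments: c ≠ 0, 1 for w, c² ≠ 1 for
    -- w², c ≠ z₀ for z/w, and c² ≠ z₀ for w²/z. Here `h` is one half.
    defect-vanishes-via : ∀ z c h → h + h ≈ 1# → c # 0# → c # 1# → c * c # 1# →
      c # proj₁ (value z) → c * c # proj₁ (value z) → defect z A.≈ A.ε
    defect-vanishes-via z c h h+h≈1 c#0 c#1 cc#1 c#z cc#z = defect-split w v z q p vw≈z vq≈w refl F[ε].refl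
      where
      z₀ = proj₁ (value z)
      z′ = proj₂ (value z)
      u = z₀ ⁻¹⟨ value#0 z ⟩

      w v q p : Argument
      w = record { value = c , c * (h * (z′ * u)) ; value#0 = c#0 ; value#1 = c#1 }
      v = quotient (value z) (value w) (value#0 z) c#0 (#-sym c#z)
      q = record
        { value   = c * c / z₀ ⟨ value#0 z ⟩ , 0#
        ; value#0 = x/y#0 (x#0y#0→xy#0 c#0 c#0) (value#0 z)
        ; value#1 = x/y#1 cc#z (value#0 z)
        }
      p = record { value = value w F[ε].* value w ; value#0 = x#0y#0→xy#0 c#0 c#0 ; value#1 = cc#1 }

      vw≈z : value v F[ε].* value w F[ε].≈ value z
      vw≈z = x/y*y≈x (value z) (value w) c#0

      zq≈ww : value z F[ε].* value q F[ε].≈ value w F[ε].* value w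
      zq≈ww = trans (*-comm z₀ _) (/-cancelʳ (c * c) (value#0 z)) , (begin
        z₀ * 0# + z′ * (c * c * u)     ≈⟨ trans (+-congʳ (zeroʳ z₀)) (+-identityˡ _) ⟩
        z′ * (c * c * u)               ≈⟨ *-identityˡ _ ⟨
        1# * (z′ * (c * c * u))        ≈⟨ *-congʳ h+h≈1 ⟨
        (h + h) * (z′ * (c * c * u))
          ≈⟨ solve 4 (λ c h z′ u → (h :+ h) :* (z′ :* (c :* c :* u))
               := c :* (c :* (h :* (z′ :* u))) :+ c :* (h :* (z′ :* u)) :* c) refl c h z′ u ⟩
        c * (c * (h * (z′ * u))) + c * (h * (z′ * u)) * c ∎)

      vq≈w : value v F[ε].* value q F[ε].≈ value w
      vq≈w = ε-Lemmas.product-via-square (⁻-inverseʳ w) vw≈z zq≈ww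

  ·ℕ-apart : CharacteristicZero → ∀ m n → (suc m ℕ.+ n) ·ℕ 1# # n ·ℕ 1#
  ·ℕ-apart char0 m n = x-y#0⇒x#y (#-congʳ (sym (begin
    (suc m ℕ.+ n) ·ℕ 1# - n ·ℕ 1#              ≈⟨ +-congʳ (×-homo-+ 1# (suc m) n) ⟩
    suc m ·ℕ 1# + n ·ℕ 1# - n ·ℕ 1#
      ≈⟨ solve 2 (λ x y → x :+ y :- y := x) refl (suc m ·ℕ 1#) (n ·ℕ 1#) ⟩
    suc m ·ℕ 1#                                ∎)) (char0 m))

  module CharacteristicZeroInversion (char0 : CharacteristicZero)
    {g ℓ} {A : AbelianGroup g ℓ} (φ : FiveTermFunction A) where
    open FiveTermFunction φ
    open Inversion φ
    open AbelianGroupLemmas A using (balanced⇒signed-sum)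
    private module A = AbelianGroup A

    private
      nat : ℕ → Carrier
      nat n = n ·ℕ 1#

      half : Carrier
      half = nat 2 ⁻¹⟨ char0 1 ⟩

      half+half≈1 : half + half ≈ 1#
      half+half≈1 = begin
        half + half            ≈⟨ +-cong (*-identityʳ half) (*-identityʳ half) ⟨
        half * 1# + half * 1#  ≈⟨ distribˡ half 1# 1# ⟨
        half * (1# + 1#)       ≈⟨ *-congˡ (+-congˡ (+-identityʳ 1#)) ⟨
        half * nat 2           ≈⟨ ⁻¹-inverseˡ (char0 1) ⟩
        1#                     ∎

      defect-vanishes-via-nat : ∀ z n → nat n # 0# → nat n # nat 1 → nat (n ℕ.* n) # nat 1 →
        nat n # proj₁ (value z) → nat (n ℕ.* n) # proj₁ (value z) → defect z A.≈ A.ε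
      defect-vanishes-via-nat z n n#0 n#1 nn#1 n#z nn#z = defect-vanishes-via z (nat n) half half+half≈1
        n#0 (#-congˡ (×-homo-1 1#) n#1) (#-congʳ (×1-homo-* n n) (#-congˡ (×-homo-1 1#) nn#1))
        n#z (#-congʳ (×1-homo-* n n) nn#z)

      -- The candidates are c = 2 with c² = 4 and c = 3 with c² = 9. These pairs are disjoint in
      -- characteristic zero, so one of them avoids z₀, without deciding equality.
      nat-apart : ∀ y → nat 2 # y ∧ nat 4 # y ⊎ nat 3 # y ∧ nat 9 # y
      nat-apart = Separation.pair-or-pair-apart apartnessRelation {nat 2} {nat 4} {nat 3} {nat 9}
        (#-sym (·ℕ-apart char0 0 2)) (#-sym (·ℕ-apart char0 6 2))
        (·ℕ-apart char0 0 3) (#-sym (·ℕ-apart char0 4 4))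

    defect-vanishes : ∀ z → defect z A.≈ A.ε
    defect-vanishes z = [ via-2 , via-3 ]′ (nat-apart (proj₁ (value z)))
      where
      via-2 : nat 2 # proj₁ (value z) ∧ nat 4 # proj₁ (value z) → defect z A.≈ A.ε
      via-2 (2#z , 4#z) = defect-vanishes-via-nat z 2
        (char0 1) (·ℕ-apart char0 0 1) (·ℕ-apart char0 2 1) 2#z 4#z

      via-3 : nat 3 # proj₁ (value z) ∧ nat 9 # proj₁ (value z) → defect z A.≈ A.ε
      via-3 (3#z , 9#z) = defect-vanishes-via-nat z 3
        (char0 2) (·ℕ-apart char0 1 1) (·ℕ-apart char0 7 1) 3#z 9#z

    signed-five-term : ∀ r₀ r₁ r₂ r₃ r₄ →
      value r₂ F[ε].* value r₀ F[ε].≈ value r₁ →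
      value r₄ F[ε].* value r₂ F[ε].≈ value r₃ →
      value r₄ F[ε].* (F[ε].1# F[ε].- value r₁) F[ε].≈ F[ε].1# F[ε].- value r₀ →
      apply r₀ A.∙ (signed A 1 (apply r₁) A.∙ (signed A 2 (apply r₂) A.∙
        (signed A 3 (apply r₃) A.∙ (signed A 4 (apply r₄) A.∙ A.ε)))) A.≈ A.ε
    signed-five-term r₀ r₁ r₂ r₃ r₄ r₂r₀≈r₁ r₄r₂≈r₃ r₄[1-r₁]≈1-r₀ = balanced⇒signed-sum
      (apply-five r₀ r₁ r₂ (r₄ ⁻) (r₃ ⁻) (record
        { ratio            = r₂r₀≈r₁
        ; complement-ratio = ⁻-transpose r₄ r₄[1-r₁]≈1-r₀
        -- r₄r₂ = r₃ is first turned into r₃·(1/r₄) = r₂, then solved for 1/r₄.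
        ; ratio-of-ratios  = ⁻-transpose r₃
            (F[ε].trans (F[ε].*-comm _ _) (⁻-transpose r₄ r₄r₂≈r₃))
        }))
      (defect-vanishes r₃) (defect-vanishes r₄)

  -- Application to five points in generic position.

  module _ (char0 : CharacteristicZero) (x : Fin 5 → Point) (generic : GenericPosition x) where
    open CrossRatio x generic hiding (D)
    private module Five = ε-Lemmas.FivePoints (vector ∘ x)

    𝐫-argument : ∀ i j k l m → Distinct i j k l m → Argument
    𝐫-argument i j k l m d = record
      { value = 𝐫 i j k l m d ; value#0 = r#0 i j k l m d ; value#1 = r#1 i j k l m d }

    𝐫-isCrossRatio : ∀ i j k l m d → Five.IsCrossRatio (𝐫 i j k l m d) i j k l m
    𝐫-isCrossRatio i j k l m d =
      x/y*y≈x _ (Five.D i j l F[ε].* Five.D i k m) (denominator#0 i j k l m d)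

    -- Genericity constrains only the reduced points. This suffices: the ε⁰-coefficient of a
    -- determinant is the determinant of the reductions, and a dual number with nonzero
    -- ε⁰-coefficient is a unit.
    D-unit : ∀ {i j k} → i ≢ j → i ≢ k → j ≢ k → ε-Lemmas.Unit (Five.D i j k)
    D-unit i≢j i≢k j≢k = _ , unit-inverseʳ _ (generic i≢j i≢k j≢k)

    private
      r₀ = 𝐫-argument 0F 1F 2F 3F 4F (punchIn-distinct 0F)
      r₁ = 𝐫-argument 1F 0F 2F 3F 4F (punchIn-distinct 1F)
      r₂ = 𝐫-argument 2F 0F 1F 3F 4F (punchIn-distinct 2F)
      r₃ = 𝐫-argument 3F 0F 1F 2F 4F (punchIn-distinct 3F)
      r₄ = 𝐫-argument 4F 0F 1F 2F 3F (punchIn-distinct 4F)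
      h₀ = 𝐫-isCrossRatio 0F 1F 2F 3F 4F (punchIn-distinct 0F)
      h₁ = 𝐫-isCrossRatio 1F 0F 2F 3F 4F (punchIn-distinct 1F)
      h₂ = 𝐫-isCrossRatio 2F 0F 1F 3F 4F (punchIn-distinct 2F)
      h₃ = 𝐫-isCrossRatio 3F 0F 1F 2F 4F (punchIn-distinct 3F)
      h₄ = 𝐫-isCrossRatio 4F 0F 1F 2F 3F (punchIn-distinct 4F)

    cross-ratios-five-term :
      ⟪ r₀ ⟫ T.∙ (signed T𝓑₂ 1 ⟪ r₁ ⟫ T.∙ (signed T𝓑₂ 2 ⟪ r₂ ⟫ T.∙
        (signed T𝓑₂ 3 ⟪ r₃ ⟫ T.∙ (signed T𝓑₂ 4 ⟪ r₄ ⟫ T.∙ T.ε)))) T.≈ T.ε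
    cross-ratios-five-term = CharacteristicZeroInversion.signed-five-term char0 bracket r₀ r₁ r₂ r₃ r₄
      (Five.r₂r₀≈r₁ D-unit h₀ h₁ h₂ h₃ h₄)
      (Five.r₄r₂≈r₃ D-unit h₀ h₁ h₂ h₃ h₄)
      (Five.r₄[1-r₁]≈1-r₀ D-unit h₀ h₁ h₂ h₃ h₄)

lemma4p4 : ∀ {c ℓ₁ ℓ₂} (F : HeytingField c ℓ₁ ℓ₂) →
  let open OverField F
      open AbelianGroup T𝓑₂ 
      open Sum commutativeMonoid using (sum)
  in CharacteristicZero →
     (x : Fin 5 → Point) (generic : GenericPosition x) →
     let open CrossRatio x generic in
     sum (λ i →
       let j = punchIn i 0F
           k = punchIn i 1F
           l = punchIn i 2F
           m = punchIn i 3F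
           d = punchIn-distinct i
       in signed T𝓑₂ (toℕ i)
            ⟨ r i j k l m d ⨟ rε i j k l m d ∣ r#0 i j k l m d ∣ r#1 i j k l m d ]₂)
     ≈ ε
lemma4p4 F char0 x generic = AbelianGroupLemmas.respects generated
  -- `sum` over `Fin 5` and the `punchIn` indices compute to the nested sum, so the underlying
  -- combinations agree by reflexivity.
  (TangentBlochGroup.cross-ratios-five-term F char0 x generic) ℤ[F[ε]].refl
  where open OverField F
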